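{- If for some $\varepsilon>0$ there is an algorithm that can determine if a given undirected, unweighted graph with $n$ nodes and $O(n)$ edges has radius $2$ or $3$ in $O(n^{2-\varepsilon})$ time, then the Hitting Set Conjecture is false.
   Context: The radius of an undirected graph $G=(V,E)$ is $\min_{x\in V}\max_{v\in V} d(x,v)$, where $d$ is the shortest path distance. Running times are in the standard word-RAM model with $O(\log n)$-bit words. Hitting Set (HS) Conjecture: there is no $\varepsilon>0$ such that for all $c\ge 1$ there is an algorithm that, given two lists of $n$ subsets of a universe $U$ of size $c\log n$, decides in $O(n^{2-\varepsilon})$ time whether there is a set in the first list that intersects every set in the second list. -}

module Defs where

open import Data.Bool.Base using (Bool; true; false; if_then_else_; _∧_; _∨_; _xor_)
open import Data.Fin.Base using (Fin; toℕ)
import Data.Fin.Base as Fin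
open import Data.Fin.Subset using (Subset; Nonempty; _∩_)
import Data.Integer.Base as ℤ
open import Data.List.Base as List using (List; []; _∷_; _++_; length; concatMap; drop; head)
open import Data.List.Membership.Propositional using (_∈_)
open import Data.List.Relation.Unary.All using (All)
open import Data.List.Relation.Unary.Unique.Propositional using (Unique)
open import Data.Maybe.Base using (Maybe; just; fromMaybe)
open import Data.Nat.Base
open import Data.Nat.DivMod using (_/_; _%_)
open import Data.Nat.Logarithm using (⌊log₂_⌋)
open import Data.Nat.Properties using (_≟_; m^n≢0)
open import Data.Product.Base using (∃-syntax; _×_; _,_; proj₁; proj₂)
open import Data.Rational.Base using (ℚ; 0ℚ; ↥_; ↧ₙ_)
import Data.Rational.Base as ℚ
open import Data.Sum.Base using (_⊎_)
open import Data.Vec.Base as Vec using (Vec; lookup; toList)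
open import Relation.Binary.PropositionalEquality using (_≡_; _≢_)
open import Relation.Nullary using (¬_; does; Reflects)

-- Finite simple undirected graphs.  Listing every edge {u , v} once, with
-- its smaller endpoint first, excludes loops and parallel edges.
record Graph : Set where
  field
    nodes   : ℕ
    edges   : List (Fin nodes × Fin nodes)
    ordered : All (λ e → proj₁ e Fin.< proj₂ e) edges
    unique  : Unique edges

open Graph public

module _ (G : Graph) where

  Adjacent : Fin (nodes G) → Fin (nodes G) → Set
  Adjacent u v = (u , v) ∈ edges G ⊎ (v , u) ∈ edges G

  data Walk : Fin (nodes G) → Fin (nodes G) → ℕ → Set where
    nil  : ∀ {u} → Walk u u 0
    cons : ∀ {u v w k} → Adjacent u v → Walk v w k → Walk u w (suc k)

  Distance : Fin (nodes G) → Fin (nodes G) → ℕ → Set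
  Distance u v k = Walk u v k × (∀ l → Walk u v l → k ≤ l)

  -- e = max_v d(x , v).  A node that does not reach every other node has
  -- infinite eccentricity, i.e. Eccentricity x e holds for no e.
  Eccentricity : Fin (nodes G) → ℕ → Set
  Eccentricity x e =
    (∀ v → ∃[ d ] Distance x v d × d ≤ e) × (∃[ v ] Distance x v e)

  Radius : ℕ → Set
  Radius r = (∃[ x ] Eccentricity x r) × (∀ x e → Eccentricity x e → r ≤ e)

record HSInstance : Set where
  field
    size     : ℕ
    universe : ℕ
    first    : Vec (Subset universe) size
    second   : Vec (Subset universe) size

open HSInstance public

HasHittingSet : HSInstance → Set
HasHittingSet I =
  ∃[ i ] (∀ j → Nonempty (lookup (first I) i ∩ lookup (second I) j))

-- Bitwise combination of the k lowest binary digits.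
bitwise : (Bool → Bool → Bool) → (k : ℕ) → ℕ → ℕ → ℕ
bitwise f zero    m n = 0
bitwise f (suc k) m n =
  (if f (m % 2 ≡ᵇ 1) (n % 2 ≡ᵇ 1) then 1 else 0) + 2 * bitwise f k (m / 2) (n / 2)

data Op : Set where
  add sub mul div mod and or xor shl shr : Op

-- Subtraction is truncated, and division and remainder by 0 give 0.
-- The number m + n is at least the number of binary digits of m and of n.
⟦_⟧ : Op → ℕ → ℕ → ℕ
⟦ add ⟧ m n       = m + n
⟦ sub ⟧ m n       = m ∸ n
⟦ mul ⟧ m n       = m * n
⟦ div ⟧ m zero    = 0
⟦ div ⟧ m (suc n) = m / suc n
⟦ mod ⟧ m zero    = 0
⟦ mod ⟧ m (suc n) = m % suc n
⟦ and ⟧ m n       = bitwise _∧_ (m + n) m n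
⟦ or  ⟧ m n       = bitwise _∨_ (m + n) m n
⟦ xor ⟧ m n       = bitwise _xor_ (m + n) m n
⟦ shl ⟧ m n       = m * 2 ^ n
⟦ shr ⟧ m n       = _/_ m (2 ^ n) {{m^n≢0 2 n}}

Register : Set
Register = ℕ

data Instruction : Set where
  const : (r : Register) (c : ℕ) → Instruction              -- r := c
  arith : Op → (r s t : Register) → Instruction             -- r := s op t
  load  : (r s : Register) → Instruction                    -- r := memory[s]
  store : (r s : Register) → Instruction                    -- memory[r] := s
  jump  : (l : ℕ) → Instruction
  jumpz : (r : Register) (l : ℕ) → Instruction              -- if r = 0 goto l
  halt  : Bool → Instruction

Program : Set
Program = List Instruction

_at_ : ∀ {A : Set} → List A → ℕ → Maybe A
xs at i = head (drop i xs)

_[_↦_] : (ℕ → ℕ) → ℕ → ℕ → (ℕ → ℕ)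
(f [ i ↦ v ]) j = if does (j ≟ i) then v else f j

record State : Set where
  constructor ⟨_,_,_⟩
  field
    pc  : ℕ
    reg : Register → ℕ
    mem : ℕ → ℕ

-- One step with w-bit words.  A register can only receive a value below
-- 2 ^ w, so all values and addresses a program uses fit into a word; an
-- instruction whose result does not fit has no transition.  Arithmetic
-- modulo 2 ^ w is available by using words twice as long together with mod.
data Step (w : ℕ) (P : Program) : State → State → Set where
  const : ∀ {p R M r c} → P at p ≡ just (const r c) → c < 2 ^ w →
          Step w P ⟨ p , R , M ⟩ ⟨ suc p , R [ r ↦ c ] , M ⟩
  arith : ∀ {p R M o r s t} → P at p ≡ just (arith o r s t) →
          ⟦ o ⟧ (R s) (R t) < 2 ^ w →
          Step w P ⟨ p , R , M ⟩ ⟨ suc p , R [ r ↦ ⟦ o ⟧ (R s) (R t) ] , M ⟩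
  load  : ∀ {p R M r s} → P at p ≡ just (load r s) → M (R s) < 2 ^ w →
          Step w P ⟨ p , R , M ⟩ ⟨ suc p , R [ r ↦ M (R s) ] , M ⟩
  store : ∀ {p R M r s} → P at p ≡ just (store r s) →
          Step w P ⟨ p , R , M ⟩ ⟨ suc p , R , M [ R r ↦ R s ] ⟩
  jump  : ∀ {p R M l} → P at p ≡ just (jump l) →
          Step w P ⟨ p , R , M ⟩ ⟨ l , R , M ⟩
  jumpz-taken : ∀ {p R M r l} → P at p ≡ just (jumpz r l) → R r ≡ 0 →
          Step w P ⟨ p , R , M ⟩ ⟨ l , R , M ⟩
  jumpz-skipped : ∀ {p R M r l} → P at p ≡ just (jumpz r l) → R r ≢ 0 →
          Step w P ⟨ p , R , M ⟩ ⟨ suc p , R , M ⟩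

-- Exec w P s b t: started in s, the program halts with answer b after
-- executing t instructions.
data Exec (w : ℕ) (P : Program) : State → Bool → ℕ → Set where
  halt : ∀ {p R M b} → P at p ≡ just (halt b) → Exec w P ⟨ p , R , M ⟩ b 1
  step : ∀ {s s′ b t} → Step w P s s′ → Exec w P s′ b t → Exec w P s b (suc t)

initial : List ℕ → State
initial input = ⟨ 0 , (λ _ → 0) , (λ i → fromMaybe 0 (input at i)) ⟩

encodeGraph : Graph → List ℕ
encodeGraph G = nodes G ∷ length (edges G) ∷
  concatMap (λ e → toℕ (proj₁ e) ∷ toℕ (proj₂ e) ∷ []) (edges G)

encodeHS : HSInstance → List ℕ
encodeHS I = size I ∷ universe I ∷ rows (first I) ++ rows (second I)
  where
  rows : ∀ {n d} → Vec (Subset d) n → List ℕ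
  rows S = concatMap (λ a → List.map (λ x → if x then 1 else 0) (toList a)) (toList S)

-- κ times the binary length of n (for n ≥ 1).
wordLength : (κ n : ℕ) → ℕ
wordLength κ n = κ * suc ⌊log₂ n ⌋

-- t ≤ C · n^(2 - ε).  For ε = p / q > 0 both sides are raised to the power q
-- and multiplied by n^p.
TimeBound : (ε : ℚ) (C n t : ℕ) → Set
TimeBound ε C n t =
  t ^ ↧ₙ ε * n ^ ℤ.∣ ↥ ε ∣ ≤ C ^ ↧ₙ ε * n ^ (2 * ↧ₙ ε)

DecidesInTime : Program → (κ C : ℕ) (ε : ℚ) (n : ℕ) → List ℕ → Set → Set
DecidesInTime P κ C ε n input A =
  ∃[ b ] ∃[ t ] Exec (wordLength κ n) P (initial input) b t
              × TimeBound ε C n t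
              × Reflects A b

-- Radius 2 versus radius 3 is a promise problem: nothing is required on
-- graphs of any other radius.
RadiusAlgorithm : (ε : ℚ) (K : ℕ) → Set
RadiusAlgorithm ε K =
  ∃[ P ] ∃[ κ ] ∃[ C ] ∀ (G : Graph) →
    length (edges G) ≤ K * nodes G →
    Radius G 2 ⊎ Radius G 3 →
    DecidesInTime P κ C ε (nodes G) (encodeGraph G) (Radius G 2)

-- The inequality 2 ^ d ≤ n ^ c says d ≤ c · log₂ n without rounding.
-- Smaller universes are universes of size c · log n with unused elements;
-- this also makes natural numbers c suffice.
HittingSetAlgorithm : (ε : ℚ) (c : ℕ) → Set
HittingSetAlgorithm ε c =
  ∃[ P ] ∃[ κ ] ∃[ C ] ∀ (I : HSInstance) →
    2 ^ universe I ≤ size I ^ c →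
    DecidesInTime P κ C ε (size I) (encodeHS I) (HasHittingSet I)

HittingSetConjecture : Set
HittingSetConjecture =
  ¬ (∃[ ε ] 0ℚ ℚ.< ε × (∀ c → 1 ≤ c → HittingSetAlgorithm ε c))

{-# OPTIONS --safe #-}
-- Every set becomes a node, joined to the elements it contains and to a
-- private copy of every element it does not contain.  Three more nodes are
-- added: x is joined to the sets of the first list and to all elements and
-- copies, y to the sets of the first list and to z.  Being within distance 2
-- of z and of a set of the second list forces a centre to be a set a of the
-- first list.  Such a node is within distance 2 of everything but the second
-- list, within distance 3 of that, and at distance 2 from b exactly when a
-- and b share an element, because private copies are shared by nobody.  So
-- the radius is 2 if there is a hitting set and 3 otherwise.
--
-- The graph has O(n log n) nodes and edges, and the logarithms are absorbed by
-- a smaller ε.  It can be built in place: each input bit yields one edge, that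
-- is two words, so writing the edges from the last to the first never destroys
-- a bit that is still to be read.
module Submission where

open import Defs
open import Data.Bool.Base using (Bool; true; false; if_then_else_)
open import Data.Fin.Base using (Fin; zero; suc; toℕ; fromℕ<)
import Data.Fin.Properties as Fin
open import Data.Fin.Subset using (Subset; _∩_)
open import Data.Fin.Subset.Properties using (x∈p∩q⁺; x∈p∩q⁻; nonempty?)
open import Data.Integer.Base as ℤ using (-[1+_])
open import Data.List.Base using (List; []; _∷_; _++_; map; replicate; length; concatMap)
import Data.List.Membership.DecPropositional as DecMembership
open import Data.List.Membership.Propositional using (_∈_; _∉_)
open import Data.List.Membership.Propositional.Properties using (∈-map⁺)
open import Data.List.Properties using (++-identityʳ; ++-assoc; length-++; length-map)
open import Data.List.Relation.Unary.All as All using (All; []; _∷_)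
import Data.List.Relation.Unary.All.Properties as All
open import Data.List.Relation.Unary.AllPairs using ([]; _∷_)
open import Data.List.Relation.Unary.Any using (here; there)
open import Data.List.Relation.Unary.Unique.Propositional using (Unique)
import Data.List.Relation.Unary.Unique.Propositional.Properties as Unique
open import Data.Maybe.Base using (just; fromMaybe)
open import Data.Nat.Base
open import Data.Nat.Coprimality using (Coprime; 1-coprimeTo)
open import Data.Nat.DivMod using (_/_; _%_; m/n≤m; m/n*n≤m; m%n<n; m<n⇒m%n≡m; m%n≡m∸m/n*n; m≡m%n+[m/n]*n; m/n≡1+[m∸n]/n; m<n*o⇒m/o<n; [m+kn]%n≡m%n)
open import Data.Nat.Logarithm using (⌊log₂_⌋; ⌊log₂⌋-mono-≤; ⌊log₂[2^n]⌋≡n)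
open import Data.Nat.Properties
open import Data.Nat.Tactic.RingSolver using (solve-∀)
open import Data.Product.Base using (∃-syntax; _×_; _,_; proj₁; proj₂)
open import Data.Product.Properties using (,-injectiveˡ; ,-injectiveʳ; ≡-dec)
open import Data.Rational.Base as ℚ using (ℚ; mkℚ; 0ℚ; *<*)
open import Data.Sum.Base using (_⊎_; inj₁; inj₂; [_,_]′; swap)
open import Data.Unit.Base using (⊤; tt)
open import Data.Vec.Base using (Vec; []; _∷_; lookup; toList)
open import Data.Vec.Properties using ([]=⇒lookup; lookup⇒[]=)
open import Function.Base using (_∘_)
open import Relation.Binary.PropositionalEquality
open import Relation.Nullary using (¬_; Dec; yes; no; contradiction; Reflects; ofʸ; ofⁿ; _×-dec_; _⊎-dec_)
open import Relation.Nullary.Decidable using (map′; decidable-stable)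
open import Relation.Unary using (Decidable)

-- Execution of programs

update-cong : ∀ {f g : ℕ → ℕ} {i i′ v v′} → i ≡ i′ → v ≡ v′ → f ≗ g → f [ i ↦ v ] ≗ g [ i′ ↦ v′ ]
update-cong {i = i} refl refl f≗g j with j ≡ᵇ i
... | true  = refl
... | false = f≗g j

update-same : ∀ (f : ℕ → ℕ) i v → (f [ i ↦ v ]) i ≡ v
update-same f i v with i ≡ᵇ i | ≡⇒≡ᵇ i i refl
... | true | _ = refl

update-other : ∀ (f : ℕ → ℕ) {i j} v → j ≢ i → (f [ i ↦ v ]) j ≡ f j
update-other f {i} {j} v j≢i with j ≡ᵇ i | ≡ᵇ⇒≡ j i
... | true  | j≡i = contradiction (j≡i tt) j≢i
... | false | _   = refl

-- States contain functions, which are compared pointwise. The lemma replaces a state by a pointwise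
-- equal one wherever registers or memory are brought into another form.
Exec-cong : ∀ {w P p R R′ M M′ b t} → R ≗ R′ → M ≗ M′ →
            Exec w P ⟨ p , R , M ⟩ b t → Exec w P ⟨ p , R′ , M′ ⟩ b t
Exec-cong R≗ M≗ (halt e) = halt e
Exec-cong R≗ M≗ (step (const e c<) ex) =
  step (const e c<) (Exec-cong (update-cong refl refl R≗) M≗ ex)
Exec-cong R≗ M≗ (step (arith {o = o} {s = s} {t = t} e v<) ex) =
  step (arith e (subst (_< _) v≡ v<)) (Exec-cong (update-cong refl v≡ R≗) M≗ ex)
  where v≡ = cong₂ ⟦ o ⟧ (R≗ s) (R≗ t)
Exec-cong {M = M} R≗ M≗ (step (load {s = s} e v<) ex) =
  step (load e (subst (_< _) v≡ v<)) (Exec-cong (update-cong refl v≡ R≗) M≗ ex)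
  where v≡ = trans (cong M (R≗ s)) (M≗ _)
Exec-cong R≗ M≗ (step (store {r = r} {s = s} e) ex) =
  step (store e) (Exec-cong R≗ (update-cong (R≗ r) (R≗ s) M≗) ex)
Exec-cong R≗ M≗ (step (jump e) ex) = step (jump e) (Exec-cong R≗ M≗ ex)
Exec-cong R≗ M≗ (step (jumpz-taken {r = r} e z) ex) =
  step (jumpz-taken e (trans (sym (R≗ r)) z)) (Exec-cong R≗ M≗ ex)
Exec-cong R≗ M≗ (step (jumpz-skipped {r = r} e nz) ex) =
  step (jumpz-skipped e (nz ∘ trans (R≗ r))) (Exec-cong R≗ M≗ ex)

relocate : ℕ → Instruction → Instruction
relocate h (jump l)    = jump (h + l)
relocate h (jumpz r l) = jumpz r (h + l)
relocate h i           = i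

at-map : ∀ {A B : Set} (f : A → B) xs i {x} → xs at i ≡ just x → map f xs at i ≡ just (f x)
at-map f (x ∷ xs) zero    refl = refl
at-map f (x ∷ xs) (suc i) e    = at-map f xs i e
at-map f []       zero    ()
at-map f []       (suc i) ()

at-++ʳ : ∀ {A : Set} (xs ys : List A) i → (xs ++ ys) at (length xs + i) ≡ ys at i
at-++ʳ []       ys i = refl
at-++ʳ (x ∷ xs) ys i = at-++ʳ xs ys i

-- Serves to append the given radius program to the reduction. Jump targets shift by `length Q`, and
-- longer words change no result because no operation wraps around.
Exec-relocate : ∀ {w w′ P R M b t} Q → w ≤ w′ → ∀ {p p′} → p′ ≡ length Q + p →
                Exec w P ⟨ p , R , M ⟩ b t →
                Exec w′ (Q ++ map (relocate (length Q)) P) ⟨ p′ , R , M ⟩ b t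
Exec-relocate {w} {w′} {P} Q w≤ = go
  where
  h = length Q

  fetch : ∀ {p p′ i} → p′ ≡ h + p → P at p ≡ just i →
          (Q ++ map (relocate h) P) at p′ ≡ just (relocate h i)
  fetch {p} refl e = trans (at-++ʳ Q _ p) (at-map (relocate h) P p e)

  next : ∀ {p p′} → p′ ≡ h + p → suc p′ ≡ h + suc p
  next {p} e = trans (cong suc e) (sym (+-suc h p))

  fits : ∀ {v} → v < 2 ^ w → v < 2 ^ w′
  fits v< = <-≤-trans v< (^-monoʳ-≤ 2 w≤)

  go : ∀ {R M b t p p′} → p′ ≡ h + p → Exec w P ⟨ p , R , M ⟩ b t →
       Exec w′ (Q ++ map (relocate h) P) ⟨ p′ , R , M ⟩ b t
  go q (halt e)                        = halt (fetch q e)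
  go q (step (const e c<) ex)          = step (const (fetch q e) (fits c<)) (go (next q) ex)
  go q (step (arith e v<) ex)          = step (arith (fetch q e) (fits v<)) (go (next q) ex)
  go q (step (load e v<) ex)           = step (load (fetch q e) (fits v<)) (go (next q) ex)
  go q (step (store e) ex)             = step (store (fetch q e)) (go (next q) ex)
  go q (step (jump e) ex)              = step (jump (fetch q e)) (go refl ex)
  go q (step (jumpz-taken e z) ex)     = step (jumpz-taken (fetch q e) z) (go refl ex)
  go q (step (jumpz-skipped e nz) ex)  = step (jumpz-skipped (fetch q e) nz) (go (next q) ex)

-- Register contents are kept as lists, because a lookup in a list with a
-- literal index computes while nested updates of functions pile up.
regs : List ℕ → Register → ℕ
regs xs r = fromMaybe 0 (xs at r)

set : List ℕ → ℕ → ℕ → List ℕ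
set []       zero    v = v ∷ []
set []       (suc i) v = 0 ∷ set [] i v
set (x ∷ xs) zero    v = v ∷ xs
set (x ∷ xs) (suc i) v = x ∷ set xs i v

regs-set : ∀ xs i v → regs xs [ i ↦ v ] ≗ regs (set xs i v)
regs-set []       zero    v zero          = refl
regs-set []       zero    v (suc zero)    = refl
regs-set []       zero    v (suc (suc j)) = refl
regs-set []       (suc i) v zero          = refl
regs-set []       (suc i) v (suc j)       = trans (update-cong {f = regs [] ∘ suc} {g = regs []} {i = i} refl refl nil-suc j) (regs-set [] i v j)
  where
  nil-suc : regs [] ∘ suc ≗ regs []
  nil-suc zero    = refl
  nil-suc (suc j) = refl
regs-set (x ∷ xs) zero    v zero          = refl
regs-set (x ∷ xs) zero    v (suc j)       = refl
regs-set (x ∷ xs) (suc i) v zero          = refl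
regs-set (x ∷ xs) (suc i) v (suc j)       = regs-set xs i v j

regs-replicate : ∀ k → regs (replicate k 0) ≗ λ _ → 0
regs-replicate zero    zero    = refl
regs-replicate zero    (suc r) = refl
regs-replicate (suc k) zero    = refl
regs-replicate (suc k) (suc r) = regs-replicate k r

-- Being a record, it lets unification recover the list `xs`, which cannot be read off the function
-- `regs xs`.
record Run (w : ℕ) (P : Program) (p : ℕ) (xs : List ℕ) (M : ℕ → ℕ) (b : Bool) (t : ℕ) : Set where
  constructor run
  field exec : Exec w P ⟨ p , regs xs , M ⟩ b t

open Run

module _ {w : ℕ} {P : Program} {p : ℕ} {xs : List ℕ} {M : ℕ → ℕ} {b : Bool} {t : ℕ} where

  private
    set-register : ∀ {p} r v → Run w P p (set xs r v) M b t → Exec w P ⟨ p , regs xs [ r ↦ v ] , M ⟩ b t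
    set-register r v ex = Exec-cong (sym ∘ regs-set xs r v) (λ _ → refl) (exec ex)

  run-const : ∀ {r c} → P at p ≡ just (const r c) → c < 2 ^ w →
              Run w P (suc p) (set xs r c) M b t → Run w P p xs M b (suc t)
  run-const e c< ex = run (step (const e c<) (set-register _ _ ex))

  run-arith : ∀ {o r s u} v → P at p ≡ just (arith o r s u) → ⟦ o ⟧ (regs xs s) (regs xs u) ≡ v → v < 2 ^ w →
              Run w P (suc p) (set xs r v) M b t → Run w P p xs M b (suc t)
  run-arith v e refl v< ex = run (step (arith e v<) (set-register _ _ ex))

  run-load : ∀ {r s} v → P at p ≡ just (load r s) → M (regs xs s) ≡ v → v < 2 ^ w →
             Run w P (suc p) (set xs r v) M b t → Run w P p xs M b (suc t)
  run-load v e refl v< ex = run (step (load e v<) (set-register _ _ ex))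

  run-store : ∀ {r s} → P at p ≡ just (store r s) →
              Run w P (suc p) xs (M [ regs xs r ↦ regs xs s ]) b t → Run w P p xs M b (suc t)
  run-store e ex = run (step (store e) (exec ex))

  run-jump : ∀ {l} → P at p ≡ just (jump l) → Run w P l xs M b t → Run w P p xs M b (suc t)
  run-jump e ex = run (step (jump e) (exec ex))

  run-jumpz-taken : ∀ {r l} → P at p ≡ just (jumpz r l) → regs xs r ≡ 0 →
                    Run w P l xs M b t → Run w P p xs M b (suc t)
  run-jumpz-taken e z ex = run (step (jumpz-taken e z) (exec ex))

  run-jumpz-skipped : ∀ {r l} → P at p ≡ just (jumpz r l) → regs xs r ≢ 0 →
                      Run w P (suc p) xs M b t → Run w P p xs M b (suc t)
  run-jumpz-skipped e nz ex = run (step (jumpz-skipped e nz) (exec ex))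

Contains : Program → ℕ → Program → Set
Contains P p []       = ⊤
Contains P p (i ∷ is) = P at p ≡ just i × Contains P (suc p) is

-- The reduction program

-- The accumulator puts `f 0`, ..., `f (k - 1)` in front of `acc` starting with the last entry, so
-- that one unfolding matches one round of a loop that writes backwards.
generate : ∀ {A : Set} → (ℕ → A) → ℕ → List A → List A
generate f zero    acc = acc
generate f (suc k) acc = generate f k (f k ∷ acc)

flatten : List (ℕ × ℕ) → List ℕ
flatten []             = []
flatten ((s , t) ∷ es) = s ∷ t ∷ flatten es

emit-pair : (ℕ → ℕ) → ℕ → ℕ → ℕ → (ℕ → ℕ)
emit-pair M o s t = (M [ suc o ↦ t ]) [ o ↦ s ]

-- Registers: 0 = number n of sets per list, 1 = universe size d, 2 = number m
-- of bits, 3 = node of the first element, 4 = output address, 5 and 6 =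
-- endpoints of the current edge, 7 = loop counter, 8 = 1, 9 = scratch,
-- 10 = d + m, 11 = number of nodes, 12 = 0.
starCode cellCode : ℕ → Program
starCode p =
  jumpz 7 (8 + p) ∷
  arith sub 7 7 8 ∷
  arith sub 6 6 8 ∷
  arith sub 4 4 8 ∷
  store 4 6 ∷
  arith sub 4 4 8 ∷
  store 4 5 ∷
  jump p ∷ []
cellCode p =
  jumpz 7 (18 + p) ∷
  arith sub 7 7 8 ∷
  const 9 2 ∷
  arith add 9 9 7 ∷
  load 9 9 ∷
  arith add 5 7 1 ∷
  arith div 6 5 1 ∷
  arith mul 9 9 6 ∷
  arith mul 9 9 1 ∷
  arith sub 5 5 9 ∷
  arith add 5 5 3 ∷
  const 9 2 ∷
  arith add 6 6 9 ∷
  arith sub 4 4 8 ∷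
  store 4 5 ∷
  arith sub 4 4 8 ∷
  store 4 6 ∷
  jump p ∷ []

-- One round of the cell loop. The bit `β` multiplies the quotient `q`, so a single formula selects
-- element or private copy without a branch. All intermediate values are at most `V`.
cell-body : ∀ {w P p M b t} n d m base {β q V} o k {r₅ r₆ r₉ r₁₀ r₁₁} → Contains P p (cellCode p) →
  M (2 + k) ≡ β → ⟦ div ⟧ (k + d) d ≡ q → β ≤ 1 → q ≤ k + d → q * d ≤ k + d → 2 ≤ base →
  k + d + base ≤ V → 2 + o ≤ V → V < 2 ^ w →
  (let target = k + d ∸ β * q * d + base in
   Run w P p (n ∷ d ∷ m ∷ base ∷ o ∷ target ∷ q + 2 ∷ k ∷ 1 ∷ 2 ∷ r₁₀ ∷ r₁₁ ∷ []) (emit-pair M o (q + 2) target) b t) →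
  Run w P p (n ∷ d ∷ m ∷ base ∷ 2 + o ∷ r₅ ∷ r₆ ∷ suc k ∷ 1 ∷ r₉ ∷ r₁₀ ∷ r₁₁ ∷ []) M b (18 + t)
cell-body {w} n d m base {β} {q} {V} o k
    (e₀ , e₁ , e₂ , e₃ , e₄ , e₅ , e₆ , e₇ , e₈ , e₉ , e₁₀ , e₁₁ , e₁₂ , e₁₃ , e₁₄ , e₁₅ , e₁₆ , e₁₇ , _)
    bit quotient β≤1 q≤ qd≤ 2≤base k≤V o≤V V< continue =
  run-jumpz-skipped e₀ (λ ()) (
  run-arith k e₁ refl (fits (≤-trans (m≤m+n k d) kd≤V)) (
  run-const e₂ 2< (
  run-arith (2 + k) e₃ refl (fits (≤-trans (+-mono-≤ 2≤base (m≤m+n k d)) (subst (_≤ V) (+-comm (k + d) base) k≤V))) (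
  run-load β e₄ bit (fits (≤-trans β≤1 (≤-trans (s≤s z≤n) (≤-trans 2≤base (≤-trans (m≤n+m base (k + d)) k≤V))))) (
  run-arith (k + d) e₅ refl (fits kd≤V) (
  run-arith q e₆ quotient (fits q≤V) (
  run-arith (β * q) e₇ refl (fits (≤-trans βq≤q q≤V)) (
  run-arith (β * q * d) e₈ refl (fits (≤-trans (*-monoˡ-≤ d βq≤q) (≤-trans qd≤ kd≤V))) (
  run-arith (k + d ∸ β * q * d) e₉ refl (fits (≤-trans (m∸n≤m (k + d) (β * q * d)) kd≤V)) (
  run-arith (k + d ∸ β * q * d + base) e₁₀ refl (fits (≤-trans (+-monoˡ-≤ base (m∸n≤m (k + d) (β * q * d))) k≤V)) (
  run-const e₁₁ 2< (
  run-arith (q + 2) e₁₂ refl (fits (≤-trans (+-mono-≤ q≤ 2≤base) k≤V)) (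
  run-arith (suc o) e₁₃ refl (fits (<⇒≤ o≤V)) (
  run-store e₁₄ (
  run-arith o e₁₅ refl (fits (<⇒≤ (<⇒≤ o≤V))) (
  run-store e₁₆ (
  run-jump e₁₇ continue)))))))))))))))))
  where
  fits : ∀ {x} → x ≤ V → x < 2 ^ w
  fits x≤V = ≤-<-trans x≤V V<

  kd≤V : k + d ≤ V
  kd≤V = ≤-trans (m≤m+n (k + d) base) k≤V

  q≤V : q ≤ V
  q≤V = ≤-trans q≤ kd≤V

  2< : 2 < 2 ^ w
  2< = fits (≤-trans 2≤base (≤-trans (m≤n+m base (k + d)) k≤V))

  βq≤q : β * q ≤ q
  βq≤q = ≤-trans (*-monoˡ-≤ q β≤1) (≤-reflexive (*-identityˡ q))

-- An empty universe is rejected at once: without elements and copies the sets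
-- of the second list would be isolated nodes.
prelude : Program
prelude =
  const 8 1 ∷
  load 0 9 ∷
  load 1 8 ∷
  jumpz 1 5 ∷
  jump 6 ∷
  halt false ∷
  arith mul 2 0 1 ∷
  arith add 2 2 2 ∷
  const 9 3 ∷
  arith add 3 0 0 ∷
  arith add 3 3 9 ∷
  arith add 10 1 2 ∷
  arith add 4 10 2 ∷
  arith add 4 4 0 ∷
  arith add 4 4 0 ∷
  arith add 4 4 8 ∷
  store 8 4 ∷
  arith add 11 3 10 ∷
  store 12 11 ∷
  -- The output address starts just behind the last edge: two words per edge after two header words.
  arith add 4 4 4 ∷
  const 9 2 ∷
  arith add 4 4 9 ∷
  -- Written backwards: first the star of y over the nodes 2 to n + 2, then the star of x over
  -- elements and copies, then that of x over the first list, and the cells last.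
  const 5 1 ∷
  const 9 3 ∷
  arith add 6 0 9 ∷
  arith add 7 0 8 ∷
  starCode 26 ++
  const 5 0 ∷
  arith add 6 11 12 ∷
  arith add 7 10 12 ∷
  starCode 37 ++
  arith add 6 0 9 ∷
  arith add 7 0 12 ∷
  starCode 47 ++
  arith add 7 2 12 ∷
  cellCode 56 ++
  -- The radius program starts with all registers 0; register 12 has never been written.
  const 0 0 ∷
  const 1 0 ∷
  const 2 0 ∷
  const 3 0 ∷
  const 4 0 ∷
  const 5 0 ∷
  const 6 0 ∷
  const 7 0 ∷
  const 8 0 ∷
  const 9 0 ∷
  const 10 0 ∷
  const 11 0 ∷ []

hittingSetProgram : Program → Program
hittingSetProgram P = prelude ++ map (relocate (length prelude)) P

m+k≡n⇒m≤n : ∀ {m n} k → m + k ≡ n → m ≤ n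
m+k≡n⇒m≤n {m} k refl = m≤m+n m k

-- Nodes: x = 0, y = 1, z = 2, then the n sets of each list, the d elements
-- from base on, and one private copy for each of the m bits.  Bit k belongs to
-- set k / d and element k % d; target k is the element if the bit is 1, since
-- k + d ∸ (k + d) / d * d = k % d, and the copy number k otherwise.
module Reduction (n d : ℕ) .{{_ : NonZero d}} (β : ℕ → ℕ) where

  m base N E : ℕ
  m = n * d + n * d
  base = n + n + 3
  N = base + (d + m)
  E = d + m + m + n + n + 1

  row target : ℕ → ℕ
  row k    = (k + d) / d + 2
  target k = k + d ∸ β k * ((k + d) / d) * d + base

  cell : ℕ → ℕ × ℕ
  cell k = row k , target k

  star : ℕ → ℕ → ℕ → ℕ × ℕ
  star c lo i = c , i + lo

  -- k input bits are still in place and es is written from address o on,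
  -- with nothing behind it.
  record Partial (k : ℕ) (es : List (ℕ × ℕ)) (o : ℕ) (M : ℕ → ℕ) : Set where
    field
      header₀ : M 0 ≡ N
      header₁ : M 1 ≡ E
      bits    : ∀ {j} → j < k → M (2 + j) ≡ β j
      output  : ∀ i → M (o + i) ≡ fromMaybe 0 (flatten es at i)

  open Partial

  emit : ∀ {k k′ es o M s t} → k′ ≤ k → 2 + k′ ≤ o → Partial k es (2 + o) M →
         Partial k′ ((s , t) ∷ es) o (emit-pair M o s t)
  emit {k} {k′} {es} {o} {M} {s} {t} k′≤k k′≤o I = record
    { header₀ = trans (below (≤-trans (s≤s z≤n) k′≤o)) (header₀ I)
    ; header₁ = trans (below (≤-trans (s≤s (s≤s z≤n)) k′≤o)) (header₁ I)
    ; bits    = λ j<k′ → trans (below (≤-trans (+-monoʳ-< 2 j<k′) k′≤o)) (bits I (<-≤-trans j<k′ k′≤k))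
    ; output  = out
    }
    where
    M′ : ℕ → ℕ
    M′ = M [ suc o ↦ t ]

    below : ∀ {j} → j < o → emit-pair M o s t j ≡ M j
    below j<o = trans (update-other M′ {i = o} s (<⇒≢ j<o)) (update-other M {i = suc o} t (<⇒≢ (m<n⇒m<1+n j<o)))

    out : ∀ i → emit-pair M o s t (o + i) ≡ fromMaybe 0 (flatten ((s , t) ∷ es) at i)
    out zero rewrite +-identityʳ o = update-same M′ o s
    out (suc zero) rewrite +-comm o 1 =
      trans (update-other M′ {i = o} s (1+n≢n)) (update-same M (suc o) t)
    out (suc (suc i)) rewrite +-suc o (suc i) | +-suc o i =
      trans (trans (update-other M′ {i = o} s (≢-sym (<⇒≢ (s≤s (m≤n⇒m≤1+n (m≤m+n o i))))))
                   (update-other M {i = suc o} t (≢-sym (<⇒≢ (s≤s (s≤s (m≤m+n o i)))))))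
            (output I i)

  initial-output : ∀ {es M} → Partial 0 es 2 M → M ≗ λ i → fromMaybe 0 ((N ∷ E ∷ flatten es) at i)
  initial-output I zero          = header₀ I
  initial-output I (suc zero)    = header₁ I
  initial-output I (suc (suc i)) = output I i

  edgeList : List (ℕ × ℕ)
  edgeList = generate cell m (generate (star 0 3) n (generate (star 0 base) (d + m) (generate (star 1 2) (n + 1) [])))

  -- Induction on the loop counter. The writes never go below `o₀`, and `2 + κ ≤ o₀` keeps them off
  -- the `κ` input bits that are still to be read.
  star-correct : ∀ {w P p b t c lo o₀ κ r₂ r₃ r₉ r₁₀ r₁₁} → Contains P p (starCode p) → 2 + κ ≤ o₀ →
    ∀ k {o v es M} → v ≡ k + lo → o ≡ k * 2 + o₀ → v < 2 ^ w → o < 2 ^ w → Partial κ es o M →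
    (∀ {M′} → Partial κ (generate (star c lo) k es) o₀ M′ →
      Run w P (8 + p) (n ∷ d ∷ r₂ ∷ r₃ ∷ o₀ ∷ c ∷ lo ∷ 0 ∷ 1 ∷ r₉ ∷ r₁₀ ∷ r₁₁ ∷ []) M′ b t) →
    Run w P p (n ∷ d ∷ r₂ ∷ r₃ ∷ o ∷ c ∷ v ∷ k ∷ 1 ∷ r₉ ∷ r₁₀ ∷ r₁₁ ∷ []) M b (k * 8 + suc t)
  star-correct (e₀ , _) κ≤ zero refl refl v< o< I continue =
    run-jumpz-taken e₀ refl (continue I)
  star-correct {lo = lo} {o₀ = o₀} code@(e₀ , e₁ , e₂ , e₃ , e₄ , e₅ , e₆ , e₇ , _) κ≤ (suc k) refl refl v< o< I continue =
    run-jumpz-skipped e₀ (λ ()) (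
    run-arith k e₁ refl (≤-<-trans (m≤m+n k lo) v<′) (
    run-arith (k + lo) e₂ refl v<′ (
    run-arith (suc (k * 2 + o₀)) e₃ refl (<⇒≤ o<) (
    run-store e₄ (
    run-arith (k * 2 + o₀) e₅ refl (<⇒≤ (<⇒≤ o<)) (
    run-store e₆ (
    run-jump e₇ (
    star-correct code κ≤ k refl refl v<′ (<⇒≤ (<⇒≤ o<))
      (emit ≤-refl (≤-trans κ≤ (m≤n+m o₀ (k * 2))) I) continue))))))))
    where v<′ = <⇒≤ v<

  -- The in-place step: bit `k` is read from address `2 + k`, then its edge goes to `2 * k + 2` and
  -- the next address, while the `k` remaining bits end before `2 + k`.
  cell-correct : ∀ {w P p b t V r₁₀ r₁₁} → Contains P p (cellCode p) → (∀ k → β k ≤ 1) →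
    m * 2 + 2 ≤ V → N ≤ V → V < 2 ^ w →
    ∀ k {o r₅ r₆ r₉ es M} → k ≤ m → o ≡ k * 2 + 2 → Partial k es o M →
    (∀ {M′ r₅ r₆ r₉} → Partial 0 (generate cell k es) 2 M′ →
      Run w P (18 + p) (n ∷ d ∷ m ∷ base ∷ 2 ∷ r₅ ∷ r₆ ∷ 0 ∷ 1 ∷ r₉ ∷ r₁₀ ∷ r₁₁ ∷ []) M′ b t) →
    Run w P p (n ∷ d ∷ m ∷ base ∷ o ∷ r₅ ∷ r₆ ∷ k ∷ 1 ∷ r₉ ∷ r₁₀ ∷ r₁₁ ∷ []) M b (k * 18 + suc t)
  cell-correct (e₀ , _) β≤1 o≤ N≤ V< zero k≤m refl I continue = run-jumpz-taken e₀ refl (continue I)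
  cell-correct {V = V} code β≤1 o≤ N≤ V< (suc k) k<m refl I continue =
    cell-body n d m base (k * 2 + 2) k code (bits I ≤-refl) (div-nonZero (k + d) d) (β≤1 k)
      (m/n≤m (k + d) d) (m/n*n≤m (k + d) d) (≤-trans (n≤1+n 2) (m≤n+m 3 (n + n)))
      (≤-trans (subst (_≤ N) (trans (+-comm base (d + k)) (cong (_+ base) (+-comm d k))) (+-monoʳ-≤ base (+-monoʳ-≤ d (<⇒≤ k<m)))) N≤)
      (≤-trans (+-monoˡ-≤ 2 (*-monoˡ-≤ 2 k<m)) o≤) V<
      (cell-correct code β≤1 o≤ N≤ V< k (<⇒≤ k<m) refl
        (emit (n≤1+n k) (≤-trans (≤-reflexive (+-comm 2 k)) (+-monoˡ-≤ 2 (m≤m*n k 2))) I) continue)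
    where
    div-nonZero : ∀ x y .{{_ : NonZero y}} → ⟦ div ⟧ x y ≡ x / y
    div-nonZero x (suc y) = refl

  -- A round of a star loop takes 8 steps and a round of the cell loop 18. The constants after the
  -- first count straight-line code together with the jump that leaves the preceding loop.
  reductionTime : ℕ → ℕ
  reductionTime t =
    25 + ((n + 1) * 8 + (4 + ((d + m) * 8 + (3 + (n * 8 + (2 + (m * 18 + (13 + t))))))))

  -- Stated for a continuation that runs from the finished encoding. The largest number that occurs
  -- is `E + E + 2`, the initial output address, so its fitting into a word suffices.
  reduction-correct : ∀ {w P b t M} → E + E + 2 < 2 ^ w → (∀ k → β k ≤ 1) →
    M 0 ≡ n → M 1 ≡ d → (∀ {j} → j < m → M (2 + j) ≡ β j) → (∀ i → M (2 + m + i) ≡ 0) →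
    (∀ {M′} → M′ ≗ (λ i → fromMaybe 0 ((N ∷ E ∷ flatten edgeList) at i)) →
      Exec w (hittingSetProgram P) ⟨ length prelude , (λ _ → 0) , M′ ⟩ b t) →
    Exec w (hittingSetProgram P) ⟨ 0 , (λ _ → 0) , M ⟩ b (reductionTime t)
  reduction-correct {w} {P} {b} {t} {M} V< β≤1 M₀ M₁ M-bits M-rest continue =
    Exec-cong (regs-replicate 12) (λ _ → refl) (exec initialise)
    where
    V = E + E + 2

    fits : ∀ {x} → x ≤ V → x < 2 ^ w
    fits x≤V = ≤-<-trans x≤V V<

    E≤V : E ≤ V
    E≤V = ≤-trans (m≤m+n E E) (m≤m+n (E + E) 2)

    d+m+m≤E : d + m + m ≤ E
    d+m+m≤E = ≤-trans (≤-trans (m≤m+n _ n) (m≤m+n _ n)) (m≤m+n _ 1)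

    d+m≤V : d + m ≤ V
    d+m≤V = ≤-trans (≤-trans (m≤m+n (d + m) m) d+m+m≤E) E≤V

    m≤E : m ≤ E
    m≤E = ≤-trans (m≤n+m m (d + m)) d+m+m≤E

    n+1≤E : n + 1 ≤ E
    n+1≤E = +-monoˡ-≤ 1 (m≤n+m n (d + m + m + n))

    3≤V : 3 ≤ V
    3≤V = +-monoˡ-≤ 2 (≤-trans (≤-trans (m≤n+m 1 n) n+1≤E) (m≤m+n E E))

    n≤V : n ≤ V
    n≤V = ≤-trans (≤-trans (m≤m+n n 1) n+1≤E) E≤V

    N≤V : N ≤ V
    N≤V = m+k≡n⇒m≤n (m + m + m + d + n + n + 1) (balance d m n)
      where
      balance : ∀ d m n → n + n + 3 + (d + m) + (m + m + m + d + n + n + 1) ≡ (d + m + m + n + n + 1) + (d + m + m + n + n + 1) + 2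
      balance = solve-∀

    base≤V : base ≤ V
    base≤V = ≤-trans (m≤m+n base (d + m)) N≤V

    n+3≤V : n + 3 ≤ V
    n+3≤V = ≤-trans (+-monoˡ-≤ 3 (m≤m+n n n)) base≤V

    m*2+2≤V : m * 2 + 2 ≤ V
    m*2+2≤V = +-monoˡ-≤ 2 (≤-trans (≤-reflexive (m*2 m)) (+-mono-≤ m≤E m≤E))
      where
      m*2 : ∀ m → m * 2 ≡ m + m
      m*2 = solve-∀

    o₃ o₂ o₁ : ℕ
    o₃ = m * 2 + 2
    o₂ = n * 2 + o₃
    o₁ = (d + m) * 2 + o₂

    o₁-eq : V ≡ (n + 1) * 2 + o₁
    o₁-eq = balance d m n
      where
      balance : ∀ d m n → (d + m + m + n + n + 1) + (d + m + m + n + n + 1) + 2 ≡ (n + 1) * 2 + ((d + m) * 2 + (n * 2 + (m * 2 + 2)))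
      balance = solve-∀

    o₁≤V : o₁ ≤ V
    o₁≤V = ≤-trans (m≤n+m o₁ ((n + 1) * 2)) (≤-reflexive (sym o₁-eq))

    o₂≤V : o₂ ≤ V
    o₂≤V = ≤-trans (m≤n+m o₂ ((d + m) * 2)) o₁≤V

    2+m≤o₃ : 2 + m ≤ o₃
    2+m≤o₃ = ≤-trans (≤-reflexive (+-comm 2 m)) (+-monoˡ-≤ 2 (m≤m*n m 2))

    2+m≤o₂ : 2 + m ≤ o₂
    2+m≤o₂ = ≤-trans 2+m≤o₃ (m≤n+m o₃ (n * 2))

    2+m≤o₁ : 2 + m ≤ o₁
    2+m≤o₁ = ≤-trans 2+m≤o₂ (m≤n+m o₂ ((d + m) * 2))

    M-header : ℕ → ℕ
    M-header = (M [ 1 ↦ E ]) [ 0 ↦ N ]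

    start : Partial m [] V M-header
    start = record
      { header₀ = refl
      ; header₁ = refl
      ; bits    = M-bits
      ; output  = out
      }
      -- Since `m ≤ E`, all addresses from `V` on lie behind the input, where the memory is 0.
      where
      beyond : ∀ i → E + E + 2 + i ≡ 2 + m + (E ∸ m + E + i)
      beyond i = trans (cong (λ e → e + E + 2 + i) (sym (m+[n∸m]≡n m≤E))) (rearrange m E (E ∸ m) i)
        where
        rearrange : ∀ m E x i → m + x + E + 2 + i ≡ 2 + m + (x + E + i)
        rearrange = solve-∀

      no-output : ∀ i → 0 ≡ fromMaybe 0 (_at_ {A = ℕ} [] i)
      no-output zero    = refl
      no-output (suc i) = refl

      out : ∀ i → M-header (V + i) ≡ fromMaybe 0 ([] at i)
      out i rewrite beyond i = trans (M-rest _) (no-output i)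

    Loop : ℕ → List ℕ → (ℕ → ℕ) → ℕ → Set
    Loop p xs M t = Run w (hittingSetProgram P) p xs M b t

    0< : 0 < 2 ^ w
    0< = fits z≤n

    clear : ∀ {M′ r₅ r₆ r₉} → Partial 0 edgeList 2 M′ →
            Loop 74 (n ∷ d ∷ m ∷ base ∷ 2 ∷ r₅ ∷ r₆ ∷ 0 ∷ 1 ∷ r₉ ∷ d + m ∷ N ∷ []) M′ (12 + t)
    clear I =
      run-const refl 0< (run-const refl 0< (run-const refl 0< (run-const refl 0< (
      run-const refl 0< (run-const refl 0< (run-const refl 0< (run-const refl 0< (
      run-const refl 0< (run-const refl 0< (run-const refl 0< (run-const refl 0< (
      run (Exec-cong (sym ∘ regs-replicate 12) (λ _ → refl) (continue (initial-output I)))))))))))))))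

    from-star₂ : ∀ {M′} →
      Partial m (generate (star 0 base) (d + m) (generate (star 1 2) (n + 1) [])) o₂ M′ →
      Loop 45 (n ∷ d ∷ m ∷ base ∷ o₂ ∷ 0 ∷ base ∷ 0 ∷ 1 ∷ 3 ∷ d + m ∷ N ∷ []) M′
        (2 + (n * 8 + (2 + (m * 18 + (13 + t)))))
    from-star₂ I =
      run-arith (n + 3) refl refl (fits n+3≤V) (
      run-arith n refl (+-identityʳ n) (fits n≤V) (
      star-correct (refl , refl , refl , refl , refl , refl , refl , refl , tt) 2+m≤o₃ n refl refl (fits n+3≤V) (fits o₂≤V) I (λ I →
      run-arith m refl (+-identityʳ m) (fits (≤-trans m≤E E≤V)) (
      cell-correct (refl , refl , refl , refl , refl , refl , refl , refl , refl , refl , refl , refl , refl , refl , refl , refl , refl , refl , tt)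
        β≤1 m*2+2≤V N≤V V< m ≤-refl refl I clear))))

    from-star₁ : ∀ {M′} → Partial m (generate (star 1 2) (n + 1) []) o₁ M′ →
      Loop 34 (n ∷ d ∷ m ∷ base ∷ o₁ ∷ 1 ∷ 2 ∷ 0 ∷ 1 ∷ 3 ∷ d + m ∷ N ∷ []) M′
        (3 + ((d + m) * 8 + (3 + (n * 8 + (2 + (m * 18 + (13 + t)))))))
    from-star₁ I =
      run-const refl 0< (
      run-arith N refl (+-identityʳ N) (fits N≤V) (
      run-arith (d + m) refl (+-identityʳ (d + m)) (fits d+m≤V) (
      star-correct (refl , refl , refl , refl , refl , refl , refl , refl , tt) 2+m≤o₂ (d + m)
        (+-comm base (d + m)) refl (fits N≤V) (fits o₁≤V) I from-star₂)))

    initialise : Loop 0 (replicate 12 0) M (reductionTime t)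
    initialise =
      run-const refl (fits (≤-trans (s≤s z≤n) 3≤V)) (
      run-load n refl M₀ (fits n≤V) (
      run-load d refl M₁ (fits (≤-trans (m≤m+n d m) d+m≤V)) (
      run-jumpz-skipped refl (≢-nonZero⁻¹ d) (
      run-jump refl (
      run-arith (n * d) refl refl (fits (≤-trans (m≤m+n (n * d) (n * d)) (≤-trans m≤E E≤V))) (
      run-arith m refl refl (fits (≤-trans m≤E E≤V)) (
      run-const refl (fits 3≤V) (
      run-arith (n + n) refl refl (fits (≤-trans (m≤m+n (n + n) 3) base≤V)) (
      run-arith base refl refl (fits base≤V) (
      run-arith (d + m) refl refl (fits d+m≤V) (
      run-arith (d + m + m) refl refl (fits (≤-trans d+m+m≤E E≤V)) (
      run-arith (d + m + m + n) refl refl (fits (≤-trans (≤-trans (m≤m+n _ n) (m≤m+n _ 1)) E≤V)) (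
      run-arith (d + m + m + n + n) refl refl (fits (≤-trans (m≤m+n _ 1) E≤V)) (
      run-arith E refl refl (fits E≤V) (
      run-store refl (
      run-arith N refl refl (fits N≤V) (
      run-store refl (
      run-arith (E + E) refl refl (fits (m≤m+n (E + E) 2)) (
      run-const refl (fits (<⇒≤ 3≤V)) (
      run-arith V refl refl V< (
      run-const refl (fits (≤-trans (s≤s z≤n) 3≤V)) (
      run-const refl (fits 3≤V) (
      run-arith (n + 3) refl refl (fits n+3≤V) (
      run-arith (n + 1) refl refl (fits (≤-trans n+1≤E E≤V)) (
      star-correct (refl , refl , refl , refl , refl , refl , refl , refl , tt) 2+m≤o₁ (n + 1)
        (sym (+-assoc n 1 2)) o₁-eq (fits n+3≤V) V< start from-star₁)))))))))))))))))))))))))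

-- Membership in generated lists

module _ {A : Set} {f : ℕ → A} where

  ∈-generate⁺ʳ : ∀ k {acc x} → x ∈ acc → x ∈ generate f k acc
  ∈-generate⁺ʳ zero    x∈ = x∈
  ∈-generate⁺ʳ (suc k) x∈ = ∈-generate⁺ʳ k (there x∈)

  ∈-generate⁺ˡ : ∀ {i k acc} → i < k → f i ∈ generate f k acc
  ∈-generate⁺ˡ {i} {suc k} i<1+k with m≤n⇒m<n∨m≡n (s≤s⁻¹ i<1+k)
  ... | inj₁ i<k  = ∈-generate⁺ˡ i<k
  ... | inj₂ refl = ∈-generate⁺ʳ k (here refl)

  ∈-generate⁻ : ∀ k {acc x} → x ∈ generate f k acc → (∃[ i ] i < k × x ≡ f i) ⊎ x ∈ acc
  ∈-generate⁻ zero    x∈ = inj₂ x∈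
  ∈-generate⁻ (suc k) x∈ with ∈-generate⁻ k x∈
  ... | inj₁ (i , i<k , x≡) = inj₁ (i , m<n⇒m<1+n i<k , x≡)
  ... | inj₂ (here x≡)      = inj₁ (k , ≤-refl , x≡)
  ... | inj₂ (there x∈′)    = inj₂ x∈′

  length-generate : ∀ k {acc} → length (generate f k acc) ≡ k + length acc
  length-generate zero    = refl
  length-generate (suc k) = trans (length-generate k) (+-suc k _)

  generate-unique : (∀ {i j} → f i ≡ f j → i ≡ j) → ∀ k {acc} →
                    (∀ {i} → i < k → f i ∉ acc) → Unique acc → Unique (generate f k acc)
  generate-unique inj zero    f∉ u = u
  generate-unique inj (suc k) f∉ u = generate-unique inj k f∉′ (All.¬Any⇒All¬ _ (f∉ ≤-refl) ∷ u)
    where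
    f∉′ : ∀ {i} → i < k → f i ∉ f k ∷ _
    f∉′ i<k (here fi≡fk) = <⇒≢ i<k (inj fi≡fk)
    f∉′ i<k (there fi∈)  = f∉ (m<n⇒m<1+n i<k) fi∈

-- Distances and the radius

least : ∀ {P : ℕ → Set} → Decidable P → ∀ k → P k → ∃[ d ] P d × (∀ l → P l → d ≤ l) × d ≤ k
least P? k pk with P? 0
least P? k       pk | yes p0 = 0 , p0 , (λ _ _ → z≤n) , z≤n
least P? zero    pk | no ¬p0 = contradiction pk ¬p0
least {P} P? (suc k) pk | no ¬p0 with least (P? ∘ suc) k pk
... | d , pd , below , d≤k = suc d , pd , below′ , s≤s d≤k
  where
  below′ : ∀ l → P l → suc d ≤ l
  below′ zero    p0 = contradiction p0 ¬p0
  below′ (suc l) pl = s≤s (below l pl)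

module _ (G : Graph) where

  -- Eccentricity at most `e`, phrased with arbitrary walks so that no shortest one has to be
  -- exhibited.
  Within : Fin (nodes G) → ℕ → Set
  Within x e = ∀ v → ∃[ l ] l ≤ e × Walk G x v l

  adjacent? : ∀ u v → Dec (Adjacent G u v)
  adjacent? u v = (u , v) ∈? edges G ⊎-dec (v , u) ∈? edges G
    where open DecMembership (≡-dec Fin._≟_ Fin._≟_) using (_∈?_)

  -- Deciding each length is what allows a shortest walk to be found constructively from a given
  -- one.
  walk? : ∀ u v → Decidable (Walk G u v)
  walk? u v zero    = map′ (λ { refl → nil }) (λ { nil → refl }) (u Fin.≟ v)
  walk? u v (suc k) = map′ (λ { (_ , a , p) → cons a p }) (λ { (cons a p) → _ , a , p })
                           (Fin.any? (λ t → adjacent? u t ×-dec walk? t v k))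

  distance : ∀ {u v k} → Walk G u v k → ∃[ d ] Distance G u v d × d ≤ k
  distance {u} {v} {k} p with least (walk? u v) k p
  ... | d , pd , below , d≤k = d , (pd , below) , d≤k

  eccentricity-within : ∀ {x e} → Eccentricity G x e → Within x e
  eccentricity-within (reach , _) v with reach v
  ... | d , (p , _) , d≤e = d , d≤e , p

  -- Turns the two walk conditions into an exact radius: a node within `suc e` of everything, but
  -- not within `e`, has a node at distance exactly `suc e`.
  radius-suc : ∀ {x e} → Within x (suc e) → (∀ y → ¬ Within y e) → Radius G (suc e)
  radius-suc {x} {e} reach none = (x , near , far) , minimal
    where
    near : ∀ v → ∃[ d ] Distance G x v d × d ≤ suc e
    near v = let (l , l≤ , p) = reach v ; (d , dist , d≤l) = distance p in d , dist , ≤-trans d≤l l≤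

    far : ∃[ v ] Distance G x v (suc e)
    far with Fin.any? (λ v → proj₁ (near v) ≟ suc e)
    ... | yes (v , d≡) = v , subst (Distance G x v) d≡ (proj₁ (proj₂ (near v)))
    ... | no none-far  = contradiction closer (none x)
      where
      closer : Within x e
      closer v = let (d , (p , _) , d≤) = near v in
        d , s≤s⁻¹ (≤∧≢⇒< d≤ (λ d≡ → none-far (v , d≡))) , p

    minimal : ∀ y e′ → Eccentricity G y e′ → suc e ≤ e′
    minimal y e′ ecc with suc e ≤? e′
    ... | yes e<e′ = e<e′
    ... | no e≮e′  = contradiction (λ v → let (l , l≤ , p) = eccentricity-within ecc v in l , ≤-trans l≤ (≮⇒≥ e≮e′) , p) (none y)

  radius-unique : ∀ {r s} → Radius G r → Radius G s → r ≡ s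
  radius-unique ((x , ex) , r≤) ((y , ey) , s≤) = ≤-antisym (r≤ y _ ey) (s≤ x _ ex)

-- The reduction graph and its radius

module ReductionGraph (n d : ℕ) .{{_ : NonZero n}} .{{_ : NonZero d}} (β : ℕ → ℕ) (β≤1 : ∀ k → β k ≤ 1) where

  open Reduction n d β

  β-bit : ∀ k → β k ≡ 0 ⊎ β k ≡ 1
  β-bit k with β k | β≤1 k
  ... | 0 | _ = inj₁ refl
  ... | 1 | _ = inj₂ refl
  ... | suc (suc _) | s≤s ()

  [k+d]/d : ∀ k → (k + d) / d ≡ suc (k / d)
  [k+d]/d k = trans (m/n≡1+[m∸n]/n (m≤n+m d k)) (cong (λ x → suc (x / d)) (m+n∸n≡m k d))

  row-≡ : ∀ k → row k ≡ k / d + 3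
  row-≡ k = trans (cong (_+ 2) ([k+d]/d k)) (sym (+-suc (k / d) 2))

  target-0 : ∀ {k} → β k ≡ 0 → target k ≡ k + d + base
  target-0 βk≡0 rewrite βk≡0 = refl

  target-1 : ∀ {k} → β k ≡ 1 → target k ≡ k % d + base
  target-1 {k} βk≡1 rewrite βk≡1 | [k+d]/d k = cong (_+ base) (begin
    k + d ∸ 1 * suc (k / d) * d  ≡⟨ cong (λ x → k + d ∸ x * d) (*-identityˡ (suc (k / d))) ⟩
    k + d ∸ (d + k / d * d)      ≡⟨ cong (_∸ (d + k / d * d)) (+-comm k d) ⟩
    d + k ∸ (d + k / d * d)      ≡⟨ [m+n]∸[m+o]≡n∸o d k (k / d * d) ⟩
    k ∸ k / d * d                ≡⟨ m%n≡m∸m/n*n k d ⟨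
    k % d                        ∎)
    where open ≡-Reasoning

  base≤target : ∀ k → base ≤ target k
  base≤target k = m≤n+m base (k + d ∸ β k * ((k + d) / d) * d)

  target<N : ∀ {k} → k < m → target k < N
  target<N {k} k<m = subst (target k <_) (+-comm (d + m) base)
    (+-monoˡ-< base {k + d ∸ β k * ((k + d) / d) * d} {d + m} (≤-<-trans (m∸n≤m (k + d) (β k * ((k + d) / d) * d)) (subst (_< d + m) (+-comm d k) (+-monoʳ-< d k<m))))

  k/d<n+n : ∀ {k} → k < m → k / d < n + n
  k/d<n+n {k} k<m = m<n*o⇒m/o<n (subst (k <_) (sym (*-distribʳ-+ d n n)) k<m)

  row<base : ∀ {k} → k < m → row k < base
  row<base {k} k<m = subst (_< base) (sym (row-≡ k)) (+-monoˡ-< 3 (k/d<n+n k<m))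

  3≤row : ∀ k → 3 ≤ row k
  3≤row k = subst (3 ≤_) (sym (row-≡ k)) (m≤n+m 3 (k / d))

  base≤N : base ≤ N
  base≤N = m≤m+n base (d + m)

  n+3≤base : n + 3 ≤ base
  n+3≤base = +-monoˡ-≤ 3 (m≤m+n n n)

  -- Copies lie at `base + d` or above and elements below, so a copy never equals an element; two
  -- copies coincide only for the same cell, and two elements only in the same column.
  target-collision : ∀ {j k} → target j ≡ target k →
                     j ≡ k ⊎ (β j ≡ 1 × β k ≡ 1 × j % d ≡ k % d)
  target-collision {j} {k} eq with β-bit j | β-bit k
  ... | inj₁ j0 | inj₁ k0 = inj₁ (+-cancelʳ-≡ d j k (+-cancelʳ-≡ base (j + d) (k + d) (trans (sym (target-0 j0)) (trans eq (target-0 k0)))))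
  ... | inj₁ j0 | inj₂ k1 = contradiction (+-cancelʳ-≡ base (j + d) (k % d) (trans (sym (target-0 j0)) (trans eq (target-1 k1))))
                                          (≢-sym (<⇒≢ (<-≤-trans (m%n<n k d) (m≤n+m d j))))
  ... | inj₂ j1 | inj₁ k0 = contradiction (+-cancelʳ-≡ base (j % d) (k + d) (trans (sym (target-1 j1)) (trans eq (target-0 k0))))
                                          (<⇒≢ (<-≤-trans (m%n<n j d) (m≤n+m d k)))
  ... | inj₂ j1 | inj₂ k1 = inj₂ (j1 , k1 , +-cancelʳ-≡ base (j % d) (k % d) (trans (sym (target-1 j1)) (trans eq (target-1 k1))))

  row-injective : ∀ {j k} → row j ≡ row k → j / d ≡ k / d
  row-injective {j} {k} eq = +-cancelʳ-≡ 3 (j / d) (k / d) (trans (sym (row-≡ j)) (trans eq (row-≡ k)))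

  -- Either the targets already determine the cell, or they give its remainder modulo `d` and the
  -- rows give the quotient.
  cell-injective : ∀ {j k} → cell j ≡ cell k → j ≡ k
  cell-injective {j} {k} eq with target-collision {j} {k} (,-injectiveʳ eq)
  ... | inj₁ j≡k           = j≡k
  ... | inj₂ (_ , _ , j%d≡k%d) =
    trans (m≡m%n+[m/n]*n j d) (trans (cong₂ (λ r q → r + q * d) j%d≡k%d (row-injective (,-injectiveˡ eq))) (sym (m≡m%n+[m/n]*n k d)))

  star-injective : ∀ {c lo i j} → star c lo i ≡ star c lo j → i ≡ j
  star-injective {lo = lo} {i} {j} eq = +-cancelʳ-≡ lo i j (,-injectiveʳ eq)

  -- A description of the edges by inequalities, convenient for case analysis. The range of `y-edge`
  -- starts at 2 and so contains z as well as the first list.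
  data Edge (s t : ℕ) : Set where
    cell-edge : ∀ {k} → k < m → s ≡ row k → t ≡ target k → Edge s t
    x-a-edge  : s ≡ 0 → 3 ≤ t → t < n + 3 → Edge s t
    x-u-edge  : s ≡ 0 → base ≤ t → t < N → Edge s t
    y-edge    : s ≡ 1 → 2 ≤ t → t < n + 3 → Edge s t

  edges₁ edges₂ edges₃ : List (ℕ × ℕ)
  edges₁ = generate (star 1 2) (n + 1) []
  edges₂ = generate (star 0 base) (d + m) edges₁
  edges₃ = generate (star 0 3) n edges₂

  ∈-edges₁⁻ : ∀ {s t} → (s , t) ∈ edges₁ → s ≡ 1 × 2 ≤ t × t < n + 3
  ∈-edges₁⁻ e∈ with ∈-generate⁻ (n + 1) e∈
  ... | inj₁ (i , i< , refl) = refl , m≤n+m 2 i , subst (i + 2 <_) (+-assoc n 1 2) (+-monoˡ-< 2 i<)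

  ∈-edges₂⁻ : ∀ {s t} → (s , t) ∈ edges₂ → (s ≡ 0 × base ≤ t × t < N) ⊎ (s , t) ∈ edges₁
  ∈-edges₂⁻ e∈ with ∈-generate⁻ (d + m) e∈
  ... | inj₁ (i , i< , refl) = inj₁ (refl , m≤n+m base i , subst (i + base <_) (+-comm (d + m) base) (+-monoˡ-< base i<))
  ... | inj₂ e∈₁             = inj₂ e∈₁

  ∈-edges₃⁻ : ∀ {s t} → (s , t) ∈ edges₃ → (s ≡ 0 × 3 ≤ t × t < n + 3) ⊎ (s , t) ∈ edges₂
  ∈-edges₃⁻ e∈ with ∈-generate⁻ n e∈
  ... | inj₁ (i , i< , refl) = inj₁ (refl , m≤n+m 3 i , +-monoˡ-< 3 i<)
  ... | inj₂ e∈₂             = inj₂ e∈₂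

  edges₃-source : ∀ {s t} → (s , t) ∈ edges₃ → s < 2
  edges₃-source e∈ with ∈-edges₃⁻ e∈
  ... | inj₁ (refl , _) = s≤s z≤n
  ... | inj₂ e∈₂ with ∈-edges₂⁻ e∈₂
  ...   | inj₁ (refl , _) = s≤s z≤n
  ...   | inj₂ e∈₁ with ∈-edges₁⁻ e∈₁
  ...     | refl , _ = ≤-refl

  ∈-edgeList⁻ : ∀ {s t} → (s , t) ∈ edgeList → Edge s t
  ∈-edgeList⁻ e∈ with ∈-generate⁻ m e∈
  ... | inj₁ (k , k<m , refl) = cell-edge k<m refl refl
  ... | inj₂ e∈₃ with ∈-edges₃⁻ e∈₃
  ...   | inj₁ (s≡ , lo , hi) = x-a-edge s≡ lo hi
  ...   | inj₂ e∈₂ with ∈-edges₂⁻ e∈₂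
  ...     | inj₁ (s≡ , lo , hi) = x-u-edge s≡ lo hi
  ...     | inj₂ e∈₁ with ∈-edges₁⁻ e∈₁
  ...       | s≡ , lo , hi = y-edge s≡ lo hi

  ∈-star⁺ : ∀ {c lo t k acc} → lo ≤ t → t < k + lo → (c , t) ∈ generate (star c lo) k acc
  ∈-star⁺ {c} {lo} {t} {k} lo≤t t<k+lo = subst (λ v → (c , v) ∈ generate (star c lo) k _) (m∸n+n≡m lo≤t)
    (∈-generate⁺ˡ (+-cancelʳ-< lo (t ∸ lo) k (subst (_< k + lo) (sym (m∸n+n≡m lo≤t)) t<k+lo)))

  ∈-edgeList⁺ : ∀ {s t} → Edge s t → (s , t) ∈ edgeList
  ∈-edgeList⁺ (cell-edge k<m refl refl) = ∈-generate⁺ˡ k<m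
  ∈-edgeList⁺ (x-a-edge refl lo hi) = ∈-generate⁺ʳ m (∈-star⁺ lo hi)
  ∈-edgeList⁺ {t = t} (x-u-edge refl lo hi) = ∈-generate⁺ʳ m (∈-generate⁺ʳ n (∈-star⁺ {k = d + m} lo (subst (t <_) (+-comm base (d + m)) hi)))
  ∈-edgeList⁺ {t = t} (y-edge refl lo hi) = ∈-generate⁺ʳ m (∈-generate⁺ʳ n (∈-generate⁺ʳ (d + m) (∈-star⁺ lo (subst (t <_) (sym (+-assoc n 1 2)) hi))))

  edgeList-unique : Unique edgeList
  edgeList-unique =
    generate-unique cell-injective m (λ _ e∈ → <⇒≱ (edges₃-source e∈) (<⇒≤ (3≤row _)))
    (generate-unique star-injective n a∉
    (generate-unique star-injective (d + m) u∉
    (generate-unique star-injective (n + 1) (λ _ ()) [])))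
    where
    u∉ : ∀ {i} → i < d + m → star 0 base i ∉ edges₁
    u∉ _ e∈ with ∈-edges₁⁻ e∈
    ... | () , _

    a∉ : ∀ {i} → i < n → star 0 3 i ∉ edges₂
    a∉ i<n e∈ with ∈-edges₂⁻ e∈
    ... | inj₁ (_ , base≤ , _) = <⇒≱ (<-≤-trans (+-monoˡ-< 3 i<n) n+3≤base) base≤
    ... | inj₂ e∈₁ with ∈-edges₁⁻ e∈₁
    ...   | () , _

  edge-bounds : ∀ {s t} → Edge s t → s < t × t < N
  edge-bounds (cell-edge {k} k<m refl refl) = <-≤-trans (row<base k<m) (base≤target k) , target<N k<m
  edge-bounds (x-a-edge refl lo hi) = <-≤-trans (s≤s z≤n) lo , <-≤-trans hi (≤-trans n+3≤base base≤N)
  edge-bounds (x-u-edge refl lo hi) = <-≤-trans (≤-trans (s≤s z≤n) (m≤n+m 3 (n + n))) lo , hi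
  edge-bounds (y-edge refl lo hi) = lo , <-≤-trans hi (≤-trans n+3≤base base≤N)

  instance
    N-nonZero : NonZero N
    N-nonZero = >-nonZero (<-≤-trans (<-≤-trans (s≤s z≤n) (m≤n+m 3 (n + n))) base≤N)

  -- Reduction modulo `N` only makes the map total; on numbers below `N` it changes nothing.
  node : ℕ → Fin N
  node i = fromℕ< (m%n<n i N)

  node-pair : ℕ × ℕ → Fin N × Fin N
  node-pair (s , t) = node s , node t

  toℕ-pair : Fin N × Fin N → ℕ × ℕ
  toℕ-pair (u , v) = toℕ u , toℕ v

  toℕ-node : ∀ {i} → i < N → toℕ (node i) ≡ i
  toℕ-node {i} i<N = trans (Fin.toℕ-fromℕ< (m%n<n i N)) (m<n⇒m%n≡m i<N)

  node-toℕ : ∀ v → node (toℕ v) ≡ v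
  node-toℕ v = Fin.toℕ-injective (toℕ-node (Fin.toℕ<n v))

  -- Order, uniqueness and encoding of the edges are all proved on numbers and transferred along
  -- this equation.
  toℕ-edges : map toℕ-pair (map node-pair edgeList) ≡ edgeList
  toℕ-edges = go edgeList (All.tabulate λ e∈ → edge-bounds (∈-edgeList⁻ e∈))
    where
    go : ∀ es → All (λ e → proj₁ e < proj₂ e × proj₂ e < N) es → map toℕ-pair (map node-pair es) ≡ es
    go []       []                  = refl
    go (e ∷ es) ((s<t , t<N) ∷ all) = cong₂ _∷_ (cong₂ _,_ (toℕ-node (<-trans s<t t<N)) (toℕ-node t<N)) (go es all)

  G : Graph
  G = record
    { nodes   = N
    ; edges   = map node-pair edgeList
    ; ordered = All.map⁻ {f = toℕ-pair} (subst (All (λ e → proj₁ e < proj₂ e)) (sym toℕ-edges)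
                  (All.tabulate λ e∈ → proj₁ (edge-bounds (∈-edgeList⁻ e∈))))
    ; unique  = Unique.map⁻ {f = toℕ-pair} (subst Unique (sym toℕ-edges) edgeList-unique)
    }

  length-edgeList : length edgeList ≡ E
  length-edgeList = begin
    length edgeList                    ≡⟨ length-generate m ⟩
    m + length edges₃                  ≡⟨ cong (m +_) (length-generate n) ⟩
    m + (n + length edges₂)            ≡⟨ cong (λ l → m + (n + l)) (length-generate (d + m)) ⟩
    m + (n + (d + m + length edges₁))  ≡⟨ cong (λ l → m + (n + (d + m + l))) (length-generate (n + 1)) ⟩
    m + (n + (d + m + (n + 1 + 0)))    ≡⟨ rearrange d m n ⟩
    E                                  ∎
    where
    open ≡-Reasoning
    rearrange : ∀ d m n → m + (n + (d + m + (n + 1 + 0))) ≡ d + m + m + n + n + 1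
    rearrange = solve-∀

  encode-edges : encodeGraph G ≡ N ∷ E ∷ flatten edgeList
  encode-edges = cong (N ∷_) (cong₂ _∷_ (trans (length-map node-pair edgeList) length-edgeList) (trans (flat (map node-pair edgeList)) (cong flatten toℕ-edges)))
    where
    flat : ∀ es → concatMap (λ e → toℕ (proj₁ e) ∷ toℕ (proj₂ e) ∷ []) es ≡ flatten (map toℕ-pair es)
    flat []       = refl
    flat (e ∷ es) = cong (λ xs → toℕ (proj₁ e) ∷ toℕ (proj₂ e) ∷ xs) (flat es)

  Adj : ℕ → ℕ → Set
  Adj s t = Edge s t ⊎ Edge t s

  adjacent⁺ : ∀ {s t} → Adj s t → Adjacent G (node s) (node t)
  adjacent⁺ (inj₁ e) = inj₁ (∈-map⁺ node-pair (∈-edgeList⁺ e))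
  adjacent⁺ (inj₂ e) = inj₂ (∈-map⁺ node-pair (∈-edgeList⁺ e))

  adjacent⁻ : ∀ {u v} → Adjacent G u v → Adj (toℕ u) (toℕ v)
  adjacent⁻ = [ inj₁ ∘ edge , inj₂ ∘ edge ]′
    where
    edge : ∀ {u v} → (u , v) ∈ edges G → Edge (toℕ u) (toℕ v)
    edge {u} {v} e∈ = ∈-edgeList⁻ (subst ((toℕ u , toℕ v) ∈_) toℕ-edges (∈-map⁺ toℕ-pair e∈))

  z-neighbour : ∀ {v} → Adj 2 v → v ≡ 1
  z-neighbour (inj₁ (cell-edge {k} _ 2≡ _)) = contradiction 2≡ (<⇒≢ (3≤row k))
  z-neighbour (inj₁ (x-a-edge () _ _))
  z-neighbour (inj₁ (x-u-edge () _ _))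
  z-neighbour (inj₁ (y-edge () _ _))
  z-neighbour (inj₂ (cell-edge {k} _ _ 2≡)) = contradiction 2≡ (<⇒≢ (≤-trans (m≤n+m 3 (n + n)) (base≤target k)))
  z-neighbour (inj₂ (x-a-edge _ (s≤s (s≤s ())) _))
  z-neighbour (inj₂ (x-u-edge _ base≤2 _)) = contradiction base≤2 (<⇒≱ (m≤n+m 3 (n + n)))
  z-neighbour (inj₂ (y-edge v≡1 _ _)) = v≡1

  y-neighbour : ∀ {v} → Adj 1 v → 2 ≤ v × v < n + 3
  y-neighbour (inj₁ (cell-edge {k} _ 1≡ _)) = contradiction 1≡ (<⇒≢ (<⇒≤ (3≤row k)))
  y-neighbour (inj₁ (x-a-edge () _ _))
  y-neighbour (inj₁ (x-u-edge () _ _))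
  y-neighbour (inj₁ (y-edge _ lo hi)) = lo , hi
  y-neighbour (inj₂ (cell-edge {k} _ _ 1≡)) = contradiction 1≡ (<⇒≢ (≤-trans (<⇒≤ (m≤n+m 3 (n + n))) (base≤target k)))
  y-neighbour (inj₂ (x-a-edge _ (s≤s ()) _))
  y-neighbour (inj₂ (x-u-edge _ base≤1 _)) = contradiction base≤1 (<⇒≱ (<⇒≤ (m≤n+m 3 (n + n))))
  y-neighbour (inj₂ (y-edge _ (s≤s ()) _))

  row-neighbour : ∀ {r v} → 3 ≤ r → r < base → Adj r v →
                  (∃[ k ] k < m × r ≡ row k × v ≡ target k) ⊎ (v < 2 × r < n + 3)
  row-neighbour 3≤r r< (inj₁ (cell-edge k<m r≡ v≡)) = inj₁ (_ , k<m , r≡ , v≡)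
  row-neighbour ()  r< (inj₁ (x-a-edge refl _ _))
  row-neighbour ()  r< (inj₁ (x-u-edge refl _ _))
  row-neighbour (s≤s ()) r< (inj₁ (y-edge refl _ _))
  row-neighbour 3≤r r< (inj₂ (cell-edge {k} _ _ refl)) = contradiction (base≤target k) (<⇒≱ r<)
  row-neighbour 3≤r r< (inj₂ (x-a-edge refl _ hi)) = inj₂ (s≤s z≤n , hi)
  row-neighbour 3≤r r< (inj₂ (x-u-edge _ lo _)) = contradiction lo (<⇒≱ r<)
  row-neighbour 3≤r r< (inj₂ (y-edge refl _ hi)) = inj₂ (≤-refl , hi)

  Near : ℕ → ℕ → Set
  Near s t = s ≡ t ⊎ Adj s t ⊎ ∃[ v ] Adj s v × Adj v t

  within⇒near : ∀ {x} → Within G x 2 → ∀ {t} → t < N → Near (toℕ x) t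
  within⇒near within {t} t<N with within (node t)
  ... | _ , _ , nil = inj₁ (toℕ-node t<N)
  ... | _ , _ , cons a nil = inj₂ (inj₁ (subst (Adj _) (toℕ-node t<N) (adjacent⁻ a)))
  ... | _ , _ , cons {v = v} a (cons a′ nil) = inj₂ (inj₂ (toℕ v , adjacent⁻ a , subst (Adj _) (toℕ-node t<N) (adjacent⁻ a′)))
  ... | _ , s≤s (s≤s ()) , cons _ (cons _ (cons _ _))

  Hits : Set
  Hits = ∃[ i ] i < n × (∀ {j} → j < n → ∃[ c ] c < d × β (i * d + c) ≡ 1 × β ((n + j) * d + c) ≡ 1)

  -- The only neighbour of z is y, so a node within two steps of z is z, y or a neighbour of y. This
  -- rules out x, the second list, the elements and the copies.
  near-z : ∀ {x} → Near x 2 → 1 ≤ x × x < n + 3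
  near-z (inj₁ refl) = s≤s z≤n , m≤n+m 3 n
  near-z (inj₂ (inj₁ a)) with z-neighbour (swap a)
  ... | refl = ≤-refl , <⇒≤ (m≤n+m 3 n)
  near-z (inj₂ (inj₂ (v , a , a′))) with z-neighbour (swap a′)
  ... | refl with y-neighbour (swap a)
  ...   | 2≤x , x< = <⇒≤ 2≤x , x<

  -- A set of the second list is adjacent to targets of its own cells only. The candidate is not
  -- such a target, so it must be adjacent to one; y and z are not, which leaves the first list.
  near-b : ∀ {x j} → 1 ≤ x → x < n + 3 → j < n → Near x (n + j + 3) →
           ∃[ k ] ∃[ l ] x ≡ row k × n + j + 3 ≡ row l × target k ≡ target l
  near-b {x} {j} 1≤x x<n+3 j<n near = go near
    where
    b = n + j + 3

    3≤b : 3 ≤ b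
    3≤b = m≤n+m 3 (n + j)

    n+3≤b : n + 3 ≤ b
    n+3≤b = +-monoˡ-≤ 3 (m≤m+n n j)

    b<base : b < base
    b<base = +-monoˡ-< 3 (+-monoʳ-< n j<n)

    b-neighbour : ∀ {v} → Adj v b → ∃[ l ] b ≡ row l × v ≡ target l
    b-neighbour a with row-neighbour 3≤b b<base (swap a)
    ... | inj₁ (l , _ , b≡ , v≡) = l , b≡ , v≡
    ... | inj₂ (_ , b<n+3)       = contradiction n+3≤b (<⇒≱ b<n+3)

    x≢target : ∀ l → x ≢ target l
    x≢target l refl = contradiction (≤-trans n+3≤base (base≤target l)) (<⇒≱ x<n+3)

    common : ∀ {l} → b ≡ row l → ∀ x → 1 ≤ x → x < n + 3 → Adj x (target l) →
             ∃[ k ] ∃[ l ] x ≡ row k × b ≡ row l × target k ≡ target l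
    common {l} b≡ (suc zero) _ _ a = contradiction (≤-trans n+3≤base (base≤target l)) (<⇒≱ (proj₂ (y-neighbour a)))
    common {l} b≡ (suc (suc zero)) _ _ a =
      contradiction (z-neighbour a) (≢-sym (<⇒≢ (≤-trans (<⇒≤ (m≤n+m 3 (n + n))) (base≤target l))))
    common {l} b≡ (suc (suc (suc x))) _ x< a with row-neighbour (s≤s (s≤s (s≤s z≤n))) (<-≤-trans x< n+3≤base) a
    ... | inj₁ (k , _ , x≡ , eq) = k , l , x≡ , b≡ , sym eq
    ... | inj₂ (t<2 , _) = contradiction (≤-trans (<⇒≤ (m≤n+m 3 (n + n))) (base≤target l)) (<⇒≱ t<2)

    go : Near x b → ∃[ k ] ∃[ l ] x ≡ row k × b ≡ row l × target k ≡ target l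
    go (inj₁ refl)                = contradiction n+3≤b (<⇒≱ x<n+3)
    go (inj₂ (inj₁ a)) with b-neighbour a
    ... | l , _ , x≡ = contradiction x≡ (x≢target l)
    go (inj₂ (inj₂ (v , a , a′))) with b-neighbour a′
    ... | l , b≡ , refl = common b≡ x 1≤x x<n+3 a

  b<N : ∀ {j} → j < n → n + j + 3 < N
  b<N j<n = <-≤-trans (+-monoˡ-< 3 (+-monoʳ-< n j<n)) base≤N

  2<N : 2 < N
  2<N = ≤-trans (m≤n+m 3 (n + n)) base≤N

  near-all⇒hits : ∀ {x} → (∀ {t} → t < N → Near x t) → Hits
  near-all⇒hits {x} near with near-z (near 2<N)
  -- The first set of the second list, present because `n` is nonzero, already forces the centre to
  -- be a row; the quotient `k₀ / d` is the index of the hitting set.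
  ... | 1≤x , x<n+3 with near-b 1≤x x<n+3 (>-nonZero⁻¹ n) (near (b<N (>-nonZero⁻¹ n)))
  ...   | k₀ , _ , x≡ , _ = k₀ / d , +-cancelʳ-< 3 (k₀ / d) n (subst (_< n + 3) x≡i+3 x<n+3) , hit
    where
    x≡i+3 : x ≡ k₀ / d + 3
    x≡i+3 = trans x≡ (row-≡ k₀)

    hit : ∀ {j} → j < n → ∃[ c ] c < d × β (k₀ / d * d + c) ≡ 1 × β ((n + j) * d + c) ≡ 1
    hit {j} j<n with near-b 1≤x x<n+3 j<n (near (b<N j<n))
    ... | k , l , x≡k , b≡l , eq with row-injective {k} {k₀} (trans (sym x≡k) x≡) | +-cancelʳ-≡ 3 (n + j) (l / d) (trans b≡l (row-≡ l))
    ...   | k/d≡ | l/d≡ with target-collision {k} {l} eq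
    -- A common cell would put the centre into the second list.
    ...     | inj₁ refl = contradiction (trans x≡k (sym b≡l)) (<⇒≢ (<-≤-trans x<n+3 (+-monoˡ-≤ 3 (m≤m+n n j))))
    ...     | inj₂ (βk , βl , k%d≡l%d) = k % d , m%n<n k d ,
              trans (cong β (trans (cong (λ q → q * d + k % d) (sym k/d≡)) (recompose k))) βk ,
              trans (cong β (trans (cong₂ (λ q r → q * d + r) l/d≡ k%d≡l%d) (recompose l))) βl
      where
      recompose : ∀ k → k / d * d + k % d ≡ k
      recompose k = trans (+-comm (k / d * d) (k % d)) (sym (m≡m%n+[m/n]*n k d))

  cell-remainder : ∀ r {c} → c < d → (r * d + c) % d ≡ c
  cell-remainder r {c} c<d = trans (cong (_% d) (+-comm (r * d) c)) (trans ([m+kn]%n≡m%n c r d) (m<n⇒m%n≡m c<d))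

  cell-quotient : ∀ r {c} → c < d → (r * d + c) / d ≡ r
  cell-quotient r {c} c<d = *-cancelʳ-≡ ((r * d + c) / d) r d (+-cancelˡ-≡ c _ _ (begin
    c + (r * d + c) / d * d                ≡⟨ cong (_+ (r * d + c) / d * d) (cell-remainder r c<d) ⟨
    (r * d + c) % d + (r * d + c) / d * d  ≡⟨ m≡m%n+[m/n]*n (r * d + c) d ⟨
    r * d + c                              ≡⟨ +-comm (r * d) c ⟩
    c + r * d                              ∎))
    where open ≡-Reasoning

  cell<m : ∀ {r c} → r < n + n → c < d → r * d + c < m
  cell<m {r} {c} r< c< = begin-strict
    r * d + c    <⟨ +-monoʳ-< (r * d) c< ⟩
    r * d + d    ≡⟨ +-comm (r * d) d ⟩
    suc r * d    ≤⟨ *-monoˡ-≤ d r< ⟩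
    (n + n) * d  ≡⟨ *-distribʳ-+ d n n ⟩
    m            ∎
    where open ≤-Reasoning

  cell-adjacent : ∀ {r c} → r < n + n → c < d → Adj (r + 3) (target (r * d + c))
  cell-adjacent {r} {c} r< c< = inj₁ (cell-edge (cell<m r< c<)
    (sym (trans (row-≡ (r * d + c)) (cong (_+ 3) (cell-quotient r c<)))) refl)

  a-adjacent-x : ∀ {i} → i < n → Adj (i + 3) 0
  a-adjacent-x {i} i<n = inj₂ (x-a-edge refl (m≤n+m 3 i) (+-monoˡ-< 3 i<n))

  -- From a set of the first list, z is reached through y, and the rest of the first list, the
  -- elements and the copies through x. Only the second list depends on the instance, so both radius
  -- bounds use this lemma.
  within-from-a : ∀ {i e} → i < n → 2 ≤ e →
                  (∀ {j} → j < n → ∃[ l ] l ≤ e × Walk G (node (i + 3)) (node (n + j + 3)) l) →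
                  Within G (node (i + 3)) e
  within-from-a {i} {e} i<n 2≤e reach-b v = subst Reach (node-toℕ v) (reach (toℕ v) (Fin.toℕ<n v))
    where
    Reach : Fin N → Set
    Reach v = ∃[ l ] l ≤ e × Walk G (node (i + 3)) v l

    via : ∀ {s t} → Adj (i + 3) s → Adj s t → Reach (node t)
    via a a′ = 2 , 2≤e , cons (adjacent⁺ a) (cons (adjacent⁺ a′) nil)

    a-y : Adj (i + 3) 1
    a-y = inj₂ (y-edge refl (<⇒≤ (m≤n+m 3 i)) (+-monoˡ-< 3 i<n))

    reach : ∀ t → t < N → Reach (node t)
    reach 0 _ = 1 , <⇒≤ 2≤e , cons (adjacent⁺ (a-adjacent-x i<n)) nil
    reach 1 _ = 1 , <⇒≤ 2≤e , cons (adjacent⁺ a-y) nil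
    reach 2 _ = via a-y (inj₁ (y-edge refl ≤-refl (m≤n+m 3 n)))
    reach t@(suc (suc (suc _))) t<N with t <? n + 3 | t <? base
    ... | yes t<n+3 | _ = via (a-adjacent-x i<n) (inj₁ (x-a-edge refl (s≤s (s≤s (s≤s z≤n))) t<n+3))
    ... | no _ | no t≮base = via (a-adjacent-x i<n) (inj₁ (x-u-edge refl (≮⇒≥ t≮base) t<N))
    ... | no t≮n+3 | yes t<base = subst (Reach ∘ node) n+j+3≡t (reach-b (+-cancelˡ-< n _ _ (+-cancelʳ-< 3 (n + j) (n + n) (subst (_< base) (sym n+j+3≡t) t<base))))
      where
      j = t ∸ (n + 3)

      n+j+3≡t : n + j + 3 ≡ t
      n+j+3≡t = trans (rearrange n j) (m+[n∸m]≡n (≮⇒≥ t≮n+3))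
        where
        rearrange : ∀ n j → n + j + 3 ≡ n + 3 + j
        rearrange = solve-∀

  hits⇒within : Hits → ∃[ x ] Within G x 2
  hits⇒within (i , i<n , hit) = node (i + 3) , within-from-a i<n ≤-refl reach-b
    where
    reach-b : ∀ {j} → j < n → ∃[ l ] l ≤ 2 × Walk G (node (i + 3)) (node (n + j + 3)) l
    reach-b {j} j<n with hit j<n
    ... | c , c<d , βi , βj = 2 , ≤-refl , cons (adjacent⁺ (cell-adjacent (<-≤-trans i<n (m≤m+n n n)) c<d))
          (cons (adjacent⁺ (subst (λ t → Adj t (n + j + 3)) (sym common) (swap (cell-adjacent (+-monoʳ-< n j<n) c<d)))) nil)
      where
      common : target (i * d + c) ≡ target ((n + j) * d + c)
      common = trans (target-1 βi) (trans (cong (_+ base) (trans (cell-remainder i c<d) (sym (cell-remainder (n + j) c<d)))) (sym (target-1 βj)))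

  within-3 : ∃[ x ] Within G x 3
  within-3 = node 3 , within-from-a (>-nonZero⁻¹ n) (n≤1+n 2) reach-b
    where
    reach-b : ∀ {j} → j < n → ∃[ l ] l ≤ 3 × Walk G (node 3) (node (n + j + 3)) l
    -- The route goes through x and the target of column 0, which exists as `d` is nonzero; element
    -- or copy, that target is adjacent to x.
    reach-b {j} j<n = 3 , ≤-refl , cons (adjacent⁺ (a-adjacent-x (>-nonZero⁻¹ n)))
      (cons (adjacent⁺ (inj₁ (x-u-edge refl (base≤target k) (target<N (cell<m n+j<n+n (>-nonZero⁻¹ d))))))
      (cons (adjacent⁺ (swap (cell-adjacent n+j<n+n (>-nonZero⁻¹ d)))) nil))
      where
      k = (n + j) * d + 0
      n+j<n+n = +-monoʳ-< n j<n

  -- The witnesses are z and the first set b of the second list: they are distinct and not adjacent,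
  -- and the only neighbour of z is y, which is not adjacent to b.
  ¬within-1 : ∀ x → ¬ Within G x 1
  ¬within-1 x within with adjacent-to 2<N | adjacent-to (b<N (>-nonZero⁻¹ n))
    where
    adjacent-to : ∀ {t} → t < N → toℕ x ≡ t ⊎ Adj (toℕ x) t
    adjacent-to {t} t<N with within (node t)
    ... | _ , _ , nil          = inj₁ (toℕ-node t<N)
    ... | _ , _ , cons a nil   = inj₂ (subst (Adj _) (toℕ-node t<N) (adjacent⁻ a))
    ... | _ , s≤s () , cons _ (cons _ _)
  ... | inj₁ x≡2 | inj₁ x≡b = contradiction (trans (sym x≡2) x≡b) (<⇒≢ (m≤n+m 3 (n + 0)))
  ... | inj₁ x≡2 | inj₂ a   =
    contradiction (z-neighbour (subst (λ s → Adj s _) x≡2 a)) (≢-sym (<⇒≢ (<⇒≤ (m≤n+m 3 (n + 0)))))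
  ... | inj₂ a   | inj₁ x≡b =
    contradiction (trans (sym (z-neighbour (swap a))) x≡b) (<⇒≢ (<⇒≤ (m≤n+m 3 (n + 0))))
  ... | inj₂ a   | inj₂ a′  =
    contradiction (proj₂ (y-neighbour (subst (λ s → Adj s _) (z-neighbour (swap a)) a′))) (≤⇒≯ (+-monoˡ-≤ 3 (m≤m+n n 0)))

  hits⇒radius-2 : Hits → Radius G 2
  hits⇒radius-2 hits = radius-suc G (proj₂ (hits⇒within hits)) ¬within-1

  ¬hits⇒radius-3 : ¬ Hits → Radius G 3
  ¬hits⇒radius-3 ¬hits = radius-suc G (proj₂ within-3) (λ x within → ¬hits (near-all⇒hits (within⇒near within)))

-- Encoded set families

bit : Bool → ℕ
bit x = if x then 1 else 0

bitRow : ∀ {d} → Subset d → List ℕ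
bitRow a = map bit (toList a)

bitRows : ∀ {n d} → Vec (Subset d) n → List ℕ
bitRows S = concatMap bitRow (toList S)

length-bitRow : ∀ {d} (a : Subset d) → length (bitRow a) ≡ d
length-bitRow []      = refl
length-bitRow (x ∷ a) = cong suc (length-bitRow a)

length-bitRows : ∀ {n d} (S : Vec (Subset d) n) → length (bitRows S) ≡ n * d
length-bitRows []      = refl
length-bitRows (a ∷ S) = trans (length-++ (bitRow a)) (cong₂ _+_ (length-bitRow a) (length-bitRows S))

bitRow-at : ∀ {d} (a : Subset d) c zs → (bitRow a ++ zs) at toℕ c ≡ just (bit (lookup a c))
bitRow-at (x ∷ a) zero    zs = refl
bitRow-at (x ∷ a) (suc c) zs = bitRow-at a c zs

skip-row : ∀ {A : Set} (xs : List A) {ys h} → length xs ≡ h → ∀ i → (xs ++ ys) at (h + i) ≡ ys at i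
skip-row xs refl i = at-++ʳ xs _ i

bitRows-at : ∀ {n d} (S : Vec (Subset d) n) r c zs →
             (bitRows S ++ zs) at (toℕ r * d + toℕ c) ≡ just (bit (lookup (lookup S r) c))
bitRows-at (a ∷ S) zero    c zs rewrite ++-assoc (bitRow a) (bitRows S) zs = bitRow-at a c (bitRows S ++ zs)
bitRows-at {d = d} (a ∷ S) (suc r) c zs rewrite ++-assoc (bitRow a) (bitRows S) zs | +-assoc d (toℕ r * d) (toℕ c) =
  trans (skip-row (bitRow a) (length-bitRow a) _) (bitRows-at S r c zs)

bit≤1 : ∀ x → bit x ≤ 1
bit≤1 true  = ≤-refl
bit≤1 false = z≤n

bitRow≤1 : ∀ {d} (a : Subset d) → All (_≤ 1) (bitRow a)
bitRow≤1 a = All.map⁺ (All.universal bit≤1 (toList a))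

bitRows≤1 : ∀ {n d} (S : Vec (Subset d) n) → All (_≤ 1) (bitRows S)
bitRows≤1 []      = []
bitRows≤1 (a ∷ S) = All.++⁺ (bitRow≤1 a) (bitRows≤1 S)

at≤1 : ∀ {xs} → All (_≤ 1) xs → ∀ k → fromMaybe 0 (xs at k) ≤ 1
at≤1 []       zero    = z≤n
at≤1 []       (suc k) = z≤n
at≤1 (x≤ ∷ _) zero    = x≤
at≤1 (_ ∷ p)  (suc k) = at≤1 p k

at-length : ∀ {A : Set} (xs : List A) i → xs at (length xs + i) ≡ [] at i
at-length xs i = trans (cong (_at (length xs + i)) (sym (++-identityʳ xs))) (at-++ʳ xs [] i)

empty-at : ∀ i → fromMaybe 0 ([] at i) ≡ 0
empty-at zero    = refl
empty-at (suc i) = refl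

bit≡1⇒true : ∀ {x} → bit x ≡ 1 → x ≡ true
bit≡1⇒true {true} _ = refl

hasHittingSet? : ∀ I → Dec (HasHittingSet I)
hasHittingSet? I = Fin.any? (λ i → Fin.all? (λ j → nonempty? (lookup (first I) i ∩ lookup (second I) j)))

-- The reduction applied to an instance: correctness and size

module HittingSetReduction (I : HSInstance) .{{_ : NonZero (size I)}} .{{_ : NonZero (universe I)}} where

  n = size I
  d = universe I

  entries : List ℕ
  entries = bitRows (first I) ++ bitRows (second I)

  -- The default 0 agrees with the zeros behind the input in the initial memory, so memory and `β`
  -- match definitionally.
  β : ℕ → ℕ
  β k = fromMaybe 0 (entries at k)

  β≤1 : ∀ k → β k ≤ 1
  β≤1 = at≤1 (All.++⁺ (bitRows≤1 (first I)) (bitRows≤1 (second I)))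

  open Reduction n d β
  open ReductionGraph n d β β≤1

  β-first : ∀ i c → β (toℕ i * d + toℕ c) ≡ bit (lookup (lookup (first I) i) c)
  β-first i c = cong (fromMaybe 0) (bitRows-at (first I) i c (bitRows (second I)))

  β-second : ∀ j c → β ((n + toℕ j) * d + toℕ c) ≡ bit (lookup (lookup (second I) j) c)
  β-second j c = cong (fromMaybe 0) (begin
    entries at ((n + toℕ j) * d + toℕ c)        ≡⟨ cong (entries at_) (trans (cong (_+ toℕ c) (*-distribʳ-+ d n (toℕ j))) (+-assoc (n * d) (toℕ j * d) (toℕ c))) ⟩
    entries at (n * d + (toℕ j * d + toℕ c))    ≡⟨ skip-row (bitRows (first I)) (length-bitRows (first I)) _ ⟩
    bitRows (second I) at (toℕ j * d + toℕ c)   ≡⟨ cong (_at (toℕ j * d + toℕ c)) (++-identityʳ (bitRows (second I))) ⟨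
    (bitRows (second I) ++ []) at (toℕ j * d + toℕ c) ≡⟨ bitRows-at (second I) j c [] ⟩
    just (bit (lookup (lookup (second I) j) c)) ∎)
    where open ≡-Reasoning

  hasHittingSet⇒hits : HasHittingSet I → Hits
  hasHittingSet⇒hits (i , meets) = toℕ i , Fin.toℕ<n i , hit
    where
    hit-at : ∀ j → ∃[ c ] c < d × β (toℕ i * d + c) ≡ 1 × β ((n + toℕ j) * d + c) ≡ 1
    hit-at j with meets j
    ... | c , c∈ with x∈p∩q⁻ (lookup (first I) i) (lookup (second I) j) c∈
    ...   | c∈i , c∈j = toℕ c , Fin.toℕ<n c ,
            trans (β-first i c) (cong bit ([]=⇒lookup c∈i)) , trans (β-second j c) (cong bit ([]=⇒lookup c∈j))

    hit : ∀ {j} → j < n → ∃[ c ] c < d × β (toℕ i * d + c) ≡ 1 × β ((n + j) * d + c) ≡ 1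
    hit j<n with hit-at (fromℕ< j<n)
    ... | result rewrite Fin.toℕ-fromℕ< j<n = result

  hits⇒hasHittingSet : Hits → HasHittingSet I
  hits⇒hasHittingSet (i , i<n , hit) = fromℕ< i<n , meets
    where
    meets : ∀ j → _
    meets j with hit (Fin.toℕ<n j)
    ... | c , c<d , βi , βj = fromℕ< c<d , x∈p∩q⁺
      ( lookup⇒[]= _ _ (bit≡1⇒true (trans (sym (β-first (fromℕ< i<n) (fromℕ< c<d))) (trans (cong₂ (λ i c → β (i * d + c)) (Fin.toℕ-fromℕ< i<n) (Fin.toℕ-fromℕ< c<d)) βi)))
      , lookup⇒[]= _ _ (bit≡1⇒true (trans (sym (β-second j (fromℕ< c<d))) (trans (cong (λ c → β ((n + toℕ j) * d + c)) (Fin.toℕ-fromℕ< c<d)) βj))) )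

  -- This is the promise under which the radius algorithm may be called.
  radius-2-or-3 : Radius G 2 ⊎ Radius G 3
  radius-2-or-3 with hasHittingSet? I
  ... | yes h = inj₁ (hits⇒radius-2 (hasHittingSet⇒hits h))
  ... | no ¬h = inj₂ (¬hits⇒radius-3 (¬h ∘ hits⇒hasHittingSet))

  radius-2⇒hasHittingSet : Radius G 2 → ¬ ¬ HasHittingSet I
  radius-2⇒hasHittingSet r ¬h =
    contradiction (radius-unique G r (¬hits⇒radius-3 (¬h ∘ hits⇒hasHittingSet))) (λ ())

  reflects-hittingSet : ∀ {b} → Reflects (Radius G 2) b → Reflects (HasHittingSet I) b
  reflects-hittingSet (ofʸ r)  = ofʸ (decidable-stable (hasHittingSet? I) (radius-2⇒hasHittingSet r))
  reflects-hittingSet (ofⁿ ¬r) = ofⁿ (¬r ∘ hits⇒radius-2 ∘ hasHittingSet⇒hits)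

  run-reduction : ∀ {w w′ P b t} → w ≤ w′ → E + E + 2 < 2 ^ w′ →
                  Exec w P (initial (encodeGraph G)) b t →
                  Exec w′ (hittingSetProgram P) (initial (encodeHS I)) b (reductionTime t)
  run-reduction {P = P} w≤w′ V< ex = reduction-correct {P = P} V< β≤1 refl refl (λ _ → refl) rest
    (λ M′≗ → Exec-relocate {P = P} prelude w≤w′ refl
      (Exec-cong (λ _ → refl) (λ i → trans (cong (λ xs → fromMaybe 0 (xs at i)) encode-edges) (sym (M′≗ i))) ex))
    where
    length-entries : length entries ≡ m
    length-entries = trans (length-++ (bitRows (first I))) (cong₂ _+_ (length-bitRows (first I)) (length-bitRows (second I)))

    rest : ∀ i → β (m + i) ≡ 0
    rest i = trans (cong (fromMaybe 0) (trans (cong (λ l → entries at (l + i)) (sym length-entries)) (at-length entries i))) (empty-at i)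

  -- The leading term `m` enters `E` twice and `N` once, which explains the density 2.
  edges-bound : length (edges G) ≤ 2 * N
  edges-bound = subst (_≤ 2 * N) (sym (trans (length-map node-pair edgeList) length-edgeList)) (m+k≡n⇒m≤n (n + n + 5 + d) (balance d m n))
    where
    balance : ∀ d m n → d + m + m + n + n + 1 + (n + n + 5 + d) ≡ 2 * (n + n + 3 + (d + m))
    balance = solve-∀

  n≤N : n ≤ N
  n≤N = ≤-trans (≤-trans (m≤m+n n n) (m≤m+n (n + n) 3)) (m≤m+n base (d + m))

  -- A common scale: as `n` is positive, it dominates 1, `n`, `d` and `n * d`.
  X : ℕ
  X = n * suc d

  -- Being a record, it lets the coefficients be inferred and summed during type checking; the
  -- numbers 8, 18 and 131 below arise in this way.
  record Linear (x k : ℕ) : Set where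
    constructor linear
    field bound : x ≤ k * X

  open Linear public

  infixl 6 _⊕_
  _⊕_ : ∀ {x y k l} → Linear x k → Linear y l → Linear (x + y) (k + l)
  _⊕_ {k = k} {l} x≤ y≤ = linear (≤-trans (+-mono-≤ (bound x≤) (bound y≤)) (≤-reflexive (sym (*-distribʳ-+ X k l))))

  times : ∀ {x k} l → Linear x k → Linear (x * l) (k * l)
  times {x} {k} l x≤ = linear (≤-trans (*-monoˡ-≤ l (bound x≤))
    (≤-reflexive (trans (*-assoc k X l) (trans (cong (k *_) (*-comm X l)) (sym (*-assoc k l X))))))

  constant : ∀ k → Linear k k
  constant k = linear (≤-trans (≤-reflexive (sym (*-identityʳ k))) (*-monoʳ-≤ k (*-mono-≤ (>-nonZero⁻¹ n) (s≤s z≤n))))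

  n-linear : Linear n 1
  n-linear = linear (≤-trans (m≤m*n n (suc d)) (m≤m+n X 0))

  d-linear : Linear d 1
  d-linear = linear (≤-trans (n≤1+n d) (≤-trans (m≤n*m (suc d) n) (m≤m+n X 0)))

  m-linear : Linear m 2
  m-linear = nd-linear ⊕ nd-linear
    where
    nd-linear : Linear (n * d) 1
    nd-linear = linear (≤-trans (*-monoʳ-≤ n (n≤1+n d)) (m≤m+n X 0))

  N-linear : Linear N 8
  N-linear = n-linear ⊕ n-linear ⊕ constant 3 ⊕ (d-linear ⊕ m-linear)

  top-linear : Linear (E + E + 2) 18
  top-linear = E-linear ⊕ E-linear ⊕ constant 2
    where
    E-linear : Linear E 8
    E-linear = d-linear ⊕ m-linear ⊕ m-linear ⊕ n-linear ⊕ n-linear ⊕ constant 1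

  reductionTime-linear : Linear (reductionTime 0) 131
  reductionTime-linear =
    constant 25 ⊕ (times 8 (n-linear ⊕ constant 1) ⊕ (constant 4 ⊕ (times 8 (d-linear ⊕ m-linear) ⊕
    (constant 3 ⊕ (times 8 n-linear ⊕ (constant 2 ⊕ (times 18 m-linear ⊕ constant 13)))))))

  reductionTime-+ : ∀ t → reductionTime t ≡ reductionTime 0 + t
  reductionTime-+ t =
    after 25 (after ((n + 1) * 8) (after 4 (after ((d + m) * 8) (after 3 (after (n * 8) (after 2 (after (m * 18) refl)))))))
    where
    after : ∀ x {y z} → y ≡ z + t → x + y ≡ x + z + t
    after x {z = z} y≡ = trans (cong (x +_) y≡) (sym (+-assoc x z t))

-- Asymptotics

^-distrib-* : ∀ a b k → (a * b) ^ k ≡ a ^ k * b ^ k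
^-distrib-* a b zero    = refl
^-distrib-* a b (suc k) = trans (cong (a * b *_) (^-distrib-* a b k)) (interchange a b (a ^ k) (b ^ k))
  where
  interchange : ∀ a b x y → a * b * (x * y) ≡ a * x * (b * y)
  interchange = solve-∀

m≤m^1+n : ∀ m n → m ≤ m ^ suc n
m≤m^1+n zero        n = z≤n
m≤m^1+n m@(suc _)   n = m≤m*n m (m ^ n) {{m^n≢0 m n}}

n<2^n : ∀ n → n < 2 ^ n
n<2^n zero    = ≤-refl
n<2^n (suc n) = begin-strict
  suc n            ≤⟨ n<2^n n ⟩
  2 ^ n            <⟨ m<m+n (2 ^ n) (m^n>0 2 n) ⟩
  2 ^ n + 2 ^ n    ≡⟨ cong (2 ^ n +_) (+-identityʳ (2 ^ n)) ⟨
  2 ^ suc n        ∎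
  where open ≤-Reasoning

n<2^log : ∀ n → n < 2 ^ suc ⌊log₂ n ⌋
n<2^log n = ≰⇒> λ 2^L≤n →
  1+n≰n (subst (_≤ ⌊log₂ n ⌋) (⌊log₂[2^n]⌋≡n (suc ⌊log₂ n ⌋)) (⌊log₂⌋-mono-≤ 2^L≤n))

-- Polynomial against exponential growth: division with remainder gives `1 + d ≤ m * (1 + d / m) ≤ m
-- * 2 ^ (d / m)`, and the `m`-th power is taken.
[1+d]^m≤m^m*2^d : ∀ d m .{{_ : NonZero m}} → suc d ^ m ≤ m ^ m * 2 ^ d
[1+d]^m≤m^m*2^d d m = begin
  suc d ^ m                    ≤⟨ ^-monoˡ-≤ m 1+d≤ ⟩
  (m * 2 ^ (d / m)) ^ m        ≡⟨ ^-distrib-* m (2 ^ (d / m)) m ⟩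
  m ^ m * (2 ^ (d / m)) ^ m    ≡⟨ cong (m ^ m *_) (^-*-assoc 2 (d / m) m) ⟩
  m ^ m * 2 ^ (d / m * m)      ≤⟨ *-monoʳ-≤ (m ^ m) (^-monoʳ-≤ 2 (m/n*n≤m d m)) ⟩
  m ^ m * 2 ^ d                ∎
  where
  open ≤-Reasoning
  1+d≤ : suc d ≤ m * 2 ^ (d / m)
  1+d≤ = begin
    suc d                    ≡⟨ cong suc (m≡m%n+[m/n]*n d m) ⟩
    suc (d % m + d / m * m)  ≤⟨ +-monoˡ-≤ (d / m * m) (m%n<n d m) ⟩
    suc (d / m) * m          ≡⟨ *-comm (suc (d / m)) m ⟩
    m * suc (d / m)          ≤⟨ *-monoʳ-≤ m (n<2^n (d / m)) ⟩
    m * 2 ^ (d / m)          ∎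

^-cancelˡ-≤ : ∀ k {a b} → a ^ suc k ≤ b ^ suc k → a ≤ b
^-cancelˡ-≤ k aᵏ≤bᵏ = ≮⇒≥ λ b<a → <⇒≱ (^-monoˡ-< (suc k) b<a) aᵏ≤bᵏ

-- The universe size is logarithmic in `n`, so a fixed power of `1 + d` is at most linear. Raising
-- to the power `suc c` makes the hypothesis applicable without roots.
polylog≤linear : ∀ c k d n → 2 ^ d ≤ n ^ suc c →
  let e = suc k * suc c in suc d ^ suc k ≤ e ^ e * n
polylog≤linear c k d n 2^d≤ = ^-cancelˡ-≤ c (begin
  (suc d ^ suc k) ^ suc c       ≡⟨ ^-*-assoc (suc d) (suc k) (suc c) ⟩
  suc d ^ e                     ≤⟨ [1+d]^m≤m^m*2^d d e ⟩
  e ^ e * 2 ^ d                 ≤⟨ *-mono-≤ (m≤m^1+n (e ^ e) c) 2^d≤ ⟩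
  (e ^ e) ^ suc c * n ^ suc c   ≡⟨ ^-distrib-* (e ^ e) n (suc c) ⟨
  (e ^ e * n) ^ suc c           ∎)
  where
  open ≤-Reasoning
  e = suc k * suc c

m≤m^n : ∀ {m n} → 1 ≤ n → m ≤ m ^ n
m≤m^n {m} {suc n} _ = m≤m^1+n m n

module _ {n δ D : ℕ} (Q : ℕ) (δ^≤ : δ ^ (2 * Q) ≤ D * n) .{{_ : NonZero n}} .{{_ : NonZero δ}} where

  -- The time `n * δ` becomes `n ^ Q * δ ^ Q`, where `δ ^ Q` costs a factor `D * n`. With the factor
  -- `n` on the left this makes `n ^ 2`, which `n ^ Q` absorbs.
  reduction-time-bound : ∀ {t} B → 2 ≤ Q → t ≤ B * (n * δ) → t ^ Q * n ≤ (B * D) ^ Q * n ^ (2 * Q)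
  reduction-time-bound {t} B 2≤Q t≤ = begin
    t ^ Q * n                            ≤⟨ *-monoˡ-≤ n (^-monoˡ-≤ Q t≤) ⟩
    (B * (n * δ)) ^ Q * n                ≡⟨ cong (_* n) (trans (^-distrib-* B (n * δ) Q) (cong (B ^ Q *_) (^-distrib-* n δ Q))) ⟩
    B ^ Q * (n ^ Q * δ ^ Q) * n          ≤⟨ *-monoˡ-≤ n (*-monoʳ-≤ (B ^ Q) (*-monoʳ-≤ (n ^ Q) (≤-trans (^-monoʳ-≤ δ (m≤m+n Q (Q + 0))) δ^≤))) ⟩
    B ^ Q * (n ^ Q * (D * n)) * n        ≡⟨ rearrange (B ^ Q) (n ^ Q) D n ⟩
    B ^ Q * D * (n ^ Q * n ^ 2)          ≤⟨ *-mono-≤ (*-monoʳ-≤ (B ^ Q) (m≤m^n (<⇒≤ 2≤Q))) (*-monoʳ-≤ (n ^ Q) (^-monoʳ-≤ n 2≤Q)) ⟩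
    B ^ Q * D ^ Q * (n ^ Q * n ^ Q)      ≡⟨ cong₂ _*_ (sym (^-distrib-* B D Q)) (trans (sym (^-distribˡ-+-* n Q Q)) (cong (λ r → n ^ (Q + r)) (sym (+-identityʳ Q)))) ⟩
    (B * D) ^ Q * n ^ (2 * Q)            ∎
    where
    open ≤-Reasoning
    rearrange : ∀ b p D n → b * (p * (D * n)) * n ≡ b * D * (p * (n * (n * 1)))
    rearrange = solve-∀

  -- Squaring the given bound leaves `N * N` on the left: one factor is lowered to `n`, the other
  -- cancels and reduces the exponent of `N` to `2 * Q - 1`. The saved factor `n` then pays for the
  -- powers of `δ`.
  radius-time-bound : ∀ {N t C} A q p .{{_ : NonZero A}} → Q ≡ suc q + suc q → n ≤ N → N ≤ A * (n * δ) →
    t ^ suc q * N ^ suc p ≤ C ^ suc q * N ^ (2 * suc q) →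
    t ^ Q * n ≤ (C * (A * A) * D) ^ Q * n ^ (2 * Q)
  radius-time-bound {N} {t} {C} A q p refl n≤N N≤ bound = begin
    t ^ Q * n                                         ≤⟨ *-cancelʳ-≤ (t ^ Q * n) (C ^ Q * N ^ r) N cancel-N ⟩
    C ^ Q * N ^ r                                     ≤⟨ *-monoʳ-≤ (C ^ Q) (^-monoˡ-≤ r N≤) ⟩
    C ^ Q * (A * (n * δ)) ^ r                         ≡⟨ cong (C ^ Q *_) (trans (^-distrib-* A (n * δ) r) (cong (A ^ r *_) (^-distrib-* n δ r))) ⟩
    C ^ Q * (A ^ r * (n ^ r * δ ^ r))                 ≤⟨ *-monoʳ-≤ (C ^ Q) (*-mono-≤ (^-monoʳ-≤ A (n≤1+n r)) (*-monoʳ-≤ (n ^ r) (≤-trans (^-monoʳ-≤ δ (n≤1+n r)) δ^≤))) ⟩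
    C ^ Q * (A ^ (2 * Q) * (n ^ r * (D * n)))         ≡⟨ rearrange (C ^ Q) (A ^ (2 * Q)) (n ^ r) D n ⟩
    C ^ Q * A ^ (2 * Q) * D * n ^ (2 * Q)             ≤⟨ *-monoˡ-≤ (n ^ (2 * Q)) (*-monoʳ-≤ (C ^ Q * A ^ (2 * Q)) (m≤m^n {D} {suc q + suc q} (s≤s z≤n))) ⟩
    C ^ Q * A ^ (2 * Q) * D ^ Q * n ^ (2 * Q)         ≡⟨ cong (λ a → C ^ Q * a * D ^ Q * n ^ (2 * Q)) A^2Q ⟩
    C ^ Q * (A * A) ^ Q * D ^ Q * n ^ (2 * Q)         ≡⟨ cong (_* n ^ (2 * Q)) (trans (cong (_* D ^ Q) (sym (^-distrib-* C (A * A) Q))) (sym (^-distrib-* (C * (A * A)) D Q))) ⟩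
    (C * (A * A) * D) ^ Q * n ^ (2 * Q)               ∎
    where
    open ≤-Reasoning
    -- This is `2 * Q - 1`, written so that `suc r` is `2 * Q` by computation.
    r = q + suc q + (Q + 0)

    instance
      N-nonZero : NonZero N
      N-nonZero = >-nonZero (<-≤-trans (>-nonZero⁻¹ n) n≤N)

    A^2Q : A ^ (2 * Q) ≡ (A * A) ^ Q
    A^2Q = trans (cong (λ x → A ^ (Q + x)) (+-identityʳ Q)) (trans (^-distribˡ-+-* A Q Q) (sym (^-distrib-* A A Q)))

    rearrange : ∀ c a x D n → c * (a * (x * (D * n))) ≡ c * a * D * (n * x)
    rearrange = solve-∀

    weaker : t ^ suc q * N ≤ C ^ suc q * N ^ (2 * suc q)
    weaker = ≤-trans (*-monoʳ-≤ (t ^ suc q) (m≤m^1+n N p)) bound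

    square : ∀ x y → (x * y) * (x * y) ≡ (x * x) * (y * y)
    square = solve-∀

    double : ∀ q → 2 * suc q + 2 * suc q ≡ 2 * (suc q + suc q)
    double = solve-∀

    cancel-N : t ^ Q * n * N ≤ C ^ Q * N ^ r * N
    cancel-N = begin
      t ^ Q * n * N                                                   ≤⟨ *-monoˡ-≤ N (*-monoʳ-≤ (t ^ Q) n≤N) ⟩
      t ^ Q * N * N                                                   ≡⟨ *-assoc (t ^ Q) N N ⟩
      t ^ Q * (N * N)                                                 ≡⟨ cong (_* (N * N)) (^-distribˡ-+-* t (suc q) (suc q)) ⟩
      t ^ suc q * t ^ suc q * (N * N)                                 ≡⟨ square (t ^ suc q) N ⟨
      t ^ suc q * N * (t ^ suc q * N)                                 ≤⟨ *-mono-≤ weaker weaker ⟩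
      C ^ suc q * N ^ (2 * suc q) * (C ^ suc q * N ^ (2 * suc q))     ≡⟨ square (C ^ suc q) (N ^ (2 * suc q)) ⟩
      C ^ suc q * C ^ suc q * (N ^ (2 * suc q) * N ^ (2 * suc q))     ≡⟨ cong₂ _*_ (^-distribˡ-+-* C (suc q) (suc q)) (^-distribˡ-+-* N (2 * suc q) (2 * suc q)) ⟨
      C ^ Q * N ^ (2 * suc q + 2 * suc q)                             ≡⟨ cong (λ e → C ^ Q * N ^ e) (double q) ⟩
      C ^ Q * (N * N ^ r)                                             ≡⟨ trans (cong (C ^ Q *_) (*-comm N (N ^ r))) (sym (*-assoc (C ^ Q) (N ^ r) N)) ⟩
      C ^ Q * N ^ r * N                                               ∎

-- A sum is at most twice its larger term, which avoids expanding a power of a sum.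
combine-time : ∀ {s t n K} C₁ C₂ Q →
  (2 * s) ^ Q * n ≤ C₁ ^ Q * K → (2 * t) ^ Q * n ≤ C₂ ^ Q * K → (s + t) ^ Q * n ≤ (C₁ + C₂) ^ Q * K
combine-time {s} {t} {n} {K} C₁ C₂ Q s≤ t≤ with ≤-total s t
... | inj₁ s≤t = ≤-trans (*-monoˡ-≤ n (^-monoˡ-≤ Q (+-mono-≤ s≤t (m≤m+n t 0)))) (≤-trans t≤ (*-monoˡ-≤ K (^-monoˡ-≤ Q (m≤n+m C₂ C₁))))
... | inj₂ t≤s = ≤-trans (*-monoˡ-≤ n (^-monoˡ-≤ Q (+-monoʳ-≤ s (≤-trans t≤s (m≤m+n s 0))))) (≤-trans s≤ (*-monoˡ-≤ K (^-monoˡ-≤ Q (m≤m+n C₁ C₂))))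

-- The value is at most `A * D * (n * n)`; each `n` costs one binary length of `n`, and the constant
-- is below `2 ^ (A * D)`.
value<2^ : ∀ {n δ D x} A → δ ≤ D * n → x ≤ A * (n * δ) → .{{_ : NonZero n}} →
           x < 2 ^ ((A * D + 2) * suc ⌊log₂ n ⌋)
value<2^ {n} {δ} {D} {x} A δ≤ x≤ = begin-strict
  x                            ≤⟨ x≤ ⟩
  A * (n * δ)                  ≤⟨ *-monoʳ-≤ A (*-monoʳ-≤ n δ≤) ⟩
  A * (n * (D * n))            ≡⟨ rearrange A n D ⟩
  A * D * (n * n)              ≤⟨ *-monoˡ-≤ (n * n) (<⇒≤ (n<2^n (A * D))) ⟩
  2 ^ (A * D) * (n * n)        <⟨ *-monoʳ-< (2 ^ (A * D)) {{m^n≢0 2 (A * D)}} (*-mono-< (n<2^log n) (n<2^log n)) ⟩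
  2 ^ (A * D) * (2 ^ L * 2 ^ L) ≡⟨ cong (2 ^ (A * D) *_) (^-distribˡ-+-* 2 L L) ⟨
  2 ^ (A * D) * 2 ^ (L + L)    ≡⟨ ^-distribˡ-+-* 2 (A * D) (L + L) ⟨
  2 ^ (A * D + (L + L))        ≤⟨ ^-monoʳ-≤ 2 (+-monoˡ-≤ (L + L) (m≤m*n (A * D) L)) ⟩
  2 ^ (A * D * L + (L + L))    ≡⟨ cong (2 ^_) (collect (A * D) L) ⟩
  2 ^ ((A * D + 2) * L)        ∎
  where
  open ≤-Reasoning
  L = suc ⌊log₂ n ⌋
  rearrange : ∀ A n D → A * (n * (D * n)) ≡ A * D * (n * n)
  rearrange = solve-∀
  collect : ∀ s L → s * L + (L + L) ≡ (s + 2) * L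
  collect = solve-∀

scale-time : ∀ {t n K} a C Q → t ^ Q * n ≤ C ^ Q * K → (a * t) ^ Q * n ≤ (a * C) ^ Q * K
scale-time {t} {n} {K} a C Q t≤ = begin
  (a * t) ^ Q * n      ≡⟨ cong (_* n) (^-distrib-* a t Q) ⟩
  a ^ Q * t ^ Q * n    ≡⟨ *-assoc (a ^ Q) (t ^ Q) n ⟩
  a ^ Q * (t ^ Q * n)  ≤⟨ *-monoʳ-≤ (a ^ Q) t≤ ⟩
  a ^ Q * (C ^ Q * K)  ≡⟨ *-assoc (a ^ Q) (C ^ Q) K ⟨
  a ^ Q * C ^ Q * K    ≡⟨ cong (_* K) (^-distrib-* a C Q) ⟨
  (a * C) ^ Q * K      ∎
  where open ≤-Reasoning

-- `N` is polynomial in `n`, so words for `N` are longer than words for `n` by a constant factor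
-- only. The summand `s` leaves room for the numbers of the reduction itself.
wordLength-poly : ∀ κ s {n N} → N < 2 ^ (s * suc ⌊log₂ n ⌋) → wordLength κ N ≤ wordLength (s + κ * suc s) n
wordLength-poly κ s {n} {N} N< = begin
  κ * suc ⌊log₂ N ⌋    ≤⟨ *-monoʳ-≤ κ (s≤s logN≤) ⟩
  κ * suc (s * L)      ≤⟨ *-monoʳ-≤ κ (+-monoˡ-≤ (s * L) (s≤s z≤n)) ⟩
  κ * (suc s * L)      ≡⟨ *-assoc κ (suc s) L ⟨
  κ * suc s * L        ≤⟨ *-monoˡ-≤ L (m≤n+m (κ * suc s) s) ⟩
  (s + κ * suc s) * L  ∎
  where
  open ≤-Reasoning
  L = suc ⌊log₂ n ⌋
  logN≤ : ⌊log₂ N ⌋ ≤ s * L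
  logN≤ = subst (⌊log₂ N ⌋ ≤_) (⌊log₂[2^n]⌋≡n (s * L)) (⌊log₂⌋-mono-≤ (<⇒≤ N<))

-- The Hitting Set algorithm

empty-universe-run : ∀ {w P M} → 1 < 2 ^ w → M 0 < 2 ^ w → M 1 ≡ 0 →
                     Exec w (hittingSetProgram P) ⟨ 0 , (λ _ → 0) , M ⟩ false 5
empty-universe-run {w} {P} {M} 1< n< M₁ = Exec-cong (regs-replicate 12) (λ _ → refl) (Run.exec reject)
  where
  reject : Run w (hittingSetProgram P) 0 (replicate 12 0) M false 5
  reject =
    run-const refl 1< (
    run-load (M 0) refl refl n< (
    run-load 0 refl M₁ (<-trans (s≤s z≤n) 1<) (
    run-jumpz-taken refl refl (
    run (halt refl)))))

-- 1 / 2q, at most half of p / q for every p ≥ 1.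
halved : ℕ → ℚ
halved q = mkℚ (ℤ.+ 1) (q + suc q) (1-coprimeTo (suc (q + suc q)))

module HittingSetDecision (p q : ℕ) .(coprime : Coprime (suc p) (suc q)) (P : Program) (κ C c : ℕ) where

  -- `Q` is the denominator of the new exponent and `D` the constant of `polylog≤linear` for the
  -- power `2 * Q`. The number 18 covers `N` and `E + E + 2`, and 131 the reduction time; the
  -- factors 2 in `C′` are those of `combine-time`.
  Q D s κ′ C′ : ℕ
  Q  = suc q + suc q
  D  = (2 * Q * suc c) ^ (2 * Q * suc c)
  s  = 18 * D + 2
  κ′ = s + κ * suc s
  C′ = 2 * (131 * D) + 2 * (C * (18 * 18) * D)

  DecidesRadius : Graph → Set
  DecidesRadius G = DecidesInTime P κ C (mkℚ (ℤ.+ suc p) q coprime) (nodes G) (encodeGraph G) (Radius G 2)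

  module _ (I : HSInstance) .{{_ : NonZero (size I)}} (small : 2 ^ universe I ≤ size I ^ suc c) where

    n d δ : ℕ
    n = size I
    d = universe I
    δ = suc d

    polylog : δ ^ (2 * Q) ≤ D * n
    polylog = polylog≤linear c (q + suc q + (Q + 0)) d n small

    δ≤ : δ ≤ D * n
    δ≤ = ≤-trans (m≤m^1+n δ (q + suc q + (Q + 0))) polylog

    fits : ∀ {x} → x ≤ 18 * (n * δ) → x < 2 ^ wordLength κ′ n
    fits x≤ = <-≤-trans (value<2^ {n} {δ} {D} 18 δ≤ x≤) (^-monoʳ-≤ 2 (*-monoˡ-≤ (suc ⌊log₂ n ⌋) (m≤m+n s (κ * suc s))))

    linear-time : ∀ {t} → t ≤ 131 * (n * δ) → (2 * t) ^ Q * n ≤ (2 * (131 * D)) ^ Q * n ^ (2 * Q)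
    linear-time {t} t≤ = scale-time {t} {n} {n ^ (2 * Q)} 2 (131 * D) Q
      (reduction-time-bound {n} {δ} {D} Q polylog {t} 131 (s≤s (≤-trans (s≤s z≤n) (m≤n+m (suc q) q))) t≤)

    time-bound : ∀ {t} → t ^ Q * n ≤ C′ ^ Q * n ^ (2 * Q) → TimeBound (halved q) C′ n t
    time-bound {t} = subst (λ x → t ^ Q * x ≤ C′ ^ Q * n ^ (2 * Q)) (sym (*-identityʳ n))

    Decides : Set
    Decides = DecidesInTime (hittingSetProgram P) κ′ C′ (halved q) n (encodeHS I) (HasHittingSet I)

    decide-empty : universe I ≡ 0 → ¬ HasHittingSet I → Decides
    decide-empty d≡0 ¬h = false , 5 , empty-universe-run {P = P} (fits 1≤) (fits n≤) d≡0 ,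
      time-bound {5} (combine-time {5} {0} {n} {n ^ (2 * Q)} (2 * (131 * D)) (2 * (C * (18 * 18) * D)) Q (linear-time {5} 5≤) z≤n) , ofⁿ ¬h
      where
      1≤X : 1 ≤ n * δ
      1≤X = *-mono-≤ (>-nonZero⁻¹ n) (s≤s z≤n)

      1≤ : 1 ≤ 18 * (n * δ)
      1≤ = *-mono-≤ {1} {18} (s≤s z≤n) 1≤X

      n≤ : n ≤ 18 * (n * δ)
      n≤ = ≤-trans (m≤m*n n δ) (m≤n*m (n * δ) 18)

      5≤ : 5 ≤ 131 * (n * δ)
      5≤ = *-mono-≤ {5} {131} (m≤m+n 5 126) 1≤X

    decide-nonempty : .{{_ : NonZero (universe I)}} →
      (∀ G → length (edges G) ≤ 2 * nodes G → Radius G 2 ⊎ Radius G 3 → DecidesRadius G) → Decides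
    decide-nonempty decideRadius = finish (decideRadius G edges-bound radius-2-or-3)
      where
      open HittingSetReduction I hiding (n; d)
      open Reduction n d β using (N; E; reductionTime)
      open ReductionGraph n d β β≤1 using (G)

      N≤ : N ≤ 18 * (n * δ)
      N≤ = ≤-trans (bound {k = 8} N-linear) (*-monoˡ-≤ (n * δ) (m≤m+n 8 10))

      finish : DecidesRadius G → Decides
      finish (b , t , ex , t≤ , r) = b , reductionTime t ,
        -- The first bound provides words for the radius program, the second for the addresses of
        -- the reduction.
        run-reduction (wordLength-poly κ s {n} {N} (value<2^ {n} {δ} {D} 18 δ≤ N≤)) (fits (bound {k = 18} top-linear)) ex ,
        subst (TimeBound (halved q) C′ n) (sym (reductionTime-+ t))
          (time-bound {reductionTime 0 + t} (combine-time {reductionTime 0} {t} {n} {n ^ (2 * Q)} (2 * (131 * D)) (2 * (C * (18 * 18) * D)) Q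
            (linear-time {reductionTime 0} (bound {k = 131} reductionTime-linear))
            (scale-time {t} {n} {n ^ (2 * Q)} 2 (C * (18 * 18) * D) Q (radius-time-bound {n} {δ} {D} Q polylog {N} {t} {C} 18 q p refl n≤N N≤ t≤)))) ,
        reflects-hittingSet r

hittingSetAlgorithm : ∀ {p q} .(coprime : Coprime (suc p) (suc q)) → RadiusAlgorithm (mkℚ (ℤ.+ suc p) q coprime) 2 →
                      ∀ c → HittingSetAlgorithm (halved q) (suc c)
hittingSetAlgorithm {p} {q} coprime (P , κ , C , decideRadius) c = hittingSetProgram P , κ′ , C′ , decide
  where
  open HittingSetDecision p q coprime P κ C c

  decide : ∀ I → 2 ^ universe I ≤ size I ^ suc c →
           DecidesInTime (hittingSetProgram P) κ′ C′ (halved q) (size I) (encodeHS I) (HasHittingSet I)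
  -- Without sets the size condition would read `2 ^ d ≤ 0`.
  decide record { size = zero ; universe = d } small = contradiction small (<⇒≱ (m^n>0 2 d))
  decide I@record { size = suc _ ; universe = zero } small = decide-empty I small refl ¬h
    where
    ¬h : ¬ HasHittingSet I
    ¬h (_ , meets) with meets zero
    ... | () , _
  decide I@record { size = suc _ ; universe = suc _ } small = decide-nonempty I small decideRadius

theorem1p1 : (∃[ ε ] 0ℚ ℚ.< ε × (∀ K → RadiusAlgorithm ε K)) → ¬ HittingSetConjecture
theorem1p1 (mkℚ (ℤ.+ suc p) q coprime , 0<ε , radius) conjecture =
  -- The new exponent depends on `ε` alone, so one exponent serves every `c`; density 2 is used
  -- throughout.
  conjecture (halved q , *<* (ℤ.+<+ (s≤s z≤n)) , λ { (suc c) _ → hittingSetAlgorithm coprime (radius 2) c })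
theorem1p1 (mkℚ (ℤ.+ zero) _ _ , *<* (ℤ.+<+ ()) , _) _
theorem1p1 (mkℚ -[1+ _ ] _ _ , *<* () , _) _
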